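{- Let $G$ be a finite graph, $k\ge1$ an integer, $\mathcal P$ any set of $k$-profiles of $G$, and $p:=|\mathcal P|$. Let $N_{\mathsf{Ext}^k}(\mathcal P)$ and $N_{\mathsf{Loc}^k}(\mathcal P)$ be obtained with respect to the set $S$ of all proper separations of $G$ of order $<k$. Then: (i) $2(p-1)\le |N_{\mathsf{Ext}^k}(\mathcal P)|\le 4(p-1)$; (ii) $2(p-1)\le |N_{\mathsf{Loc}^k}(\mathcal P)|\le 4(p-1)$; (iii) if $G$ is $(k-1)$-connected, then $|N_{\mathsf{Ext}^k}(\mathcal P)|\le 2p$.
   Context: Separations: A separation of $G=(V,E)$ is an ordered pair $(A,B)$ with $A\cup B=V$ such that no edge joins $A\setminus B$ to $B\setminus A$; its order is $|A\cap B|$, and it is an $\ell$-separation if its order is $\ell$. It is proper if neither $A\subseteq B$ nor $B\subseteq A$. Write $(A,B)\le(C,D)$ if $A\subseteq C$ and $B\supseteq D$. Two separations are nested if one is $\le$-comparable with the other or with the other's inverse (the inverse of $(C,D)$ is $(D,C)$); otherwise they cross. A separation system is a set $S$ of separations closed under taking inverses; it is proper if all its elements are proper. An orientation of $S$ is a subset containing exactly one of $(A,B),(B,A)$ for every $(A,B)\in S$. A set $O$ of separations is consistent if there are no $(A,B),(C,D)\in O$ (not necessarily distinct) with $(D,C)\le(A,B)$. An $S$-profile is a consistent orientation $P$ of $S$ such that for all $(A,B),(C,D)\in P$ we have $(B\cap D,A\cup C)\notin P$. A $k$-profile of $G$ is an $S$-profile where $S$ is the set of all separations of $G$ of order $<k$.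 Tasks: A task is a pair $(S,\mathcal P)$ where $S$ is a proper separation system of $G$ and $\mathcal P$ is a set of profiles orienting $S$ (profiles $P$ of a larger separation system are viewed as profiles of $S$ via $P\cap S$). A separation $(A,B)\in S$ is $\mathcal P$-relevant if $(A,B)\in P$ and $(B,A)\in P'$ for some $P,P'\in\mathcal P$. The reduction of $(S,\mathcal P)$ is $(R,\mathcal P)$, where $R\subseteq S$ is the set of $\mathcal P$-relevant separations. A separation $(A,B)\in S$ is extremal in $S$ if for every $(C,D)\in S$ either $(C,D)\le(A,B)$ or $(D,C)\le(A,B)$. A profile $P\in\mathcal P$ is well separated in $S$ if the $\le$-maximal elements of $P\cap S$ are pairwise nested. A separation is locally maximal in $(S,\mathcal P)$ if it is a $\le$-maximal element of $P\cap S$ for some well separated $P\in\mathcal P$. Let $\mathsf{ext_r}(S,\mathcal P)$ be the set of all $(A,B)$ such that $(A,B)$ or $(B,A)$ is extremal in $R$, and let $\mathsf{loc_r}(S,\mathcal P)$ be the set of all $(A,B)$ such that $(A,B)$ or $(B,A)$ is locally maximal in $(R,\mathcal P)$, where $(R,\mathcal P)$ is the reduction of $(S,\mathcal P)$. Strategies: For $(\Sigma,\sigma)=(\mathsf{Ext},\mathsf{ext_r})$ or $(\mathsf{Loc},\mathsf{loc_r})$, the set $N_\Sigma(S,\mathcal P)$ is defined recursively. If $R=\emptyset$, then $N_\Sigma(S,\mathcal P):=\emptyset$. Otherwise let $N:=\sigma(S,\mathcal P)$, let $\mathcal O_N$ be the set of all consistent orientations of $N$, and for $O\in\mathcal O_N$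 let $\mathcal P_O:=\{P\in\mathcal P:O\subseteq P\}$ and let $S_O$ be the set of those $(A,B)\in S$, nested with every element of $N$, for which both $O\cup\{(A,B)\}$ and $O\cup\{(B,A)\}$ are consistent. Then $N_\Sigma(S,\mathcal P):=N\cup\bigcup_{O\in\mathcal O_N}N_\Sigma(S_O,\mathcal P_O)$. Iterated strategies: Let $\mathcal P$ be a set of $k$-profiles. For $1\le\ell\le k$ let $\mathcal P_\ell$ be the set of all $\ell$-profiles of $G$ that extend to (are contained in) a $k$-profile in $\mathcal P$, and let $\mathcal P_0:=\{\emptyset\}$. For $\Sigma\in\{\mathsf{Ext},\mathsf{Loc}\}$ put $N_0:=\emptyset$ and, for $\ell=1,\dots,k$, $$N_\ell:=N_{\ell-1}\cup\bigcup_{P\in\mathcal P_{\ell-1}}N_\Sigma\big(S^\ell,\{Q\in\mathcal P_\ell: P\subseteq Q\}\big),$$ where $S^\ell$ is the set of all proper $(\ell-1)$-separations of $G$ that are nested with every element of $N_{\ell-1}$. Then $N_{\Sigma^k}(\mathcal P):=N_k$. (So $\mathsf{Ext}^k$ and $\mathsf{Loc}^k$ are the $k$-strategies all of whose entries are $\mathsf{Ext}$, respectively $\mathsf{Loc}$.) $G$ is $(k-1)$-connected if $|V|>k-1$ and no set of fewer than $k-1$ vertices separates $G$. -}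

module Defs where

open import Data.Bool.Base using (Bool; T)
open import Data.Fin.Base using (Fin)
open import Data.Fin.Subset using (Subset; ⊤; ∣_∣; _∩_; _∪_; _─_)
  renaming (_∈_ to _∈ᵥ_; _∉_ to _∉ᵥ_; _⊆_ to _⊆ᵥ_)
open import Data.Nat.Base using (ℕ; zero; suc; _<_)
open import Data.Product.Base using (_×_; _,_; ∃; ∃-syntax; swap)
open import Data.Sum.Base using (_⊎_)
open import Function.Base using (_∘_)
open import Function.Definitions using (Injective)
open import Level using (0ℓ)
open import Relation.Binary.Construct.Closure.ReflexiveTransitive using (Star)
open import Relation.Binary.Core using (Rel)
open import Relation.Binary.Definitions using (Decidable; Symmetric; Irreflexive)
open import Relation.Binary.PropositionalEquality using (_≡_)
open import Relation.Nullary.Negation using (¬_)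
open import Relation.Unary using (Pred; _∈_; _∉_; _⊆_; ∅; Satisfiable; ｛_｝)
  renaming (_∪_ to _∪ᵖ_; _∩_ to _∩ᵖ_)

record Graph (n : ℕ) : Set₁ where
  field
    Adj        : Rel (Fin n) 0ℓ
    adj?       : Decidable Adj
    adj-sym    : Symmetric Adj
    adj-irrefl : Irreflexive _≡_ Adj

-- X has exactly m elements up to _≈_.
record HasCardinality {A : Set} (_≈_ : Rel A 0ℓ) (X : Pred A 0ℓ) (m : ℕ) : Set where
  field
    enum      : Fin m → A
    sound     : ∀ i → enum i ∈ X
    injective : Injective _≡_ _≈_ enum
    complete  : ∀ {x} → x ∈ X → ∃[ i ] enum i ≈ x

-- Raw pairs (A , B) of vertex sets; that such a pair is a separation of a
-- given graph is the predicate IsSeparation.  The inverse of s is swap s.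
Sep : ℕ → Set
Sep n = Subset n × Subset n

-- Sets of separations that are themselves elements of sets (profiles) or are
-- quantified over (orientations) are given by characteristic functions, which
-- are compared by pointwise equality _≗_.
SepSet : ℕ → Set
SepSet n = Sep n → Bool

⟦_⟧ : ∀ {n} → SepSet n → Pred (Sep n) 0ℓ
⟦ P ⟧ = T ∘ P

module _ {n : ℕ} where

  order : Sep n → ℕ
  order (A , B) = ∣ A ∩ B ∣

  Proper : Pred (Sep n) 0ℓ
  Proper (A , B) = ¬ (A ⊆ᵥ B) × ¬ (B ⊆ᵥ A)

  infix 4 _≼_

  _≼_ : Rel (Sep n) 0ℓ
  (A , B) ≼ (C , D) = A ⊆ᵥ C × D ⊆ᵥ B

  Comparable : Rel (Sep n) 0ℓ
  Comparable s t = s ≼ t ⊎ t ≼ s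

  Nested : Rel (Sep n) 0ℓ
  Nested s t = Comparable s t ⊎ Comparable s (swap t)

  NestedWithAll : Pred (Sep n) 0ℓ → Pred (Sep n) 0ℓ
  NestedWithAll N s = ∀ {t} → t ∈ N → Nested s t

  Maximal : Pred (Sep n) 0ℓ → Pred (Sep n) 0ℓ
  Maximal X s = s ∈ X × (∀ {t} → t ∈ X → s ≼ t → t ≡ s)

  Consistent : Pred (Sep n) 0ℓ → Set
  Consistent O = ∀ {s t} → s ∈ O → t ∈ O → ¬ (swap t ≼ s)

  Orients : Pred (Sep n) 0ℓ → Pred (Sep n) 0ℓ → Set
  Orients O S =
    O ⊆ S ×
    (∀ {s} → s ∈ S → (s ∈ O × swap s ∉ O) ⊎ (s ∉ O × swap s ∈ O))

  record IsProfileOf (S : Pred (Sep n) 0ℓ) (P : SepSet n) : Set where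
    field
      orients    : Orients ⟦ P ⟧ S
      consistent : Consistent ⟦ P ⟧
      profile    : ∀ {A B C D} → (A , B) ∈ ⟦ P ⟧ → (C , D) ∈ ⟦ P ⟧ →
                   (B ∩ D , A ∪ C) ∉ ⟦ P ⟧

  -- The two components S and 𝒫 of a task are passed separately.  A profile of
  -- a separation system larger than S is kept as it is; only its intersection
  -- with S matters below.
  Relevant : Pred (Sep n) 0ℓ → Pred (SepSet n) 0ℓ → Pred (Sep n) 0ℓ
  Relevant S 𝒫 s =
    s ∈ S ×
    (∃[ P ] P ∈ 𝒫 × s ∈ ⟦ P ⟧) ×
    (∃[ P′ ] P′ ∈ 𝒫 × swap s ∈ ⟦ P′ ⟧)

  Extremal : Pred (Sep n) 0ℓ → Pred (Sep n) 0ℓ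
  Extremal S s = s ∈ S × (∀ {t} → t ∈ S → t ≼ s ⊎ swap t ≼ s)

  WellSeparated : Pred (Sep n) 0ℓ → SepSet n → Set
  WellSeparated S P =
    ∀ {s t} → s ∈ Maximal (⟦ P ⟧ ∩ᵖ S) → t ∈ Maximal (⟦ P ⟧ ∩ᵖ S) → Nested s t

  LocallyMaximal : Pred (Sep n) 0ℓ → Pred (SepSet n) 0ℓ → Pred (Sep n) 0ℓ
  LocallyMaximal S 𝒫 s =
    ∃[ P ] P ∈ 𝒫 × WellSeparated S P × s ∈ Maximal (⟦ P ⟧ ∩ᵖ S)

-- The choice of σ in the recursion, mapping a task (S , 𝒫) to σ(S , 𝒫).
Selector : ℕ → Set₁
Selector n = Pred (Sep n) 0ℓ → Pred (SepSet n) 0ℓ → Pred (Sep n) 0ℓ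

module _ {n : ℕ} where

  extᵣ : Selector n
  extᵣ S 𝒫 s = Extremal (Relevant S 𝒫) s ⊎ Extremal (Relevant S 𝒫) (swap s)

  locᵣ : Selector n
  locᵣ S 𝒫 s =
    LocallyMaximal (Relevant S 𝒫) 𝒫 s ⊎ LocallyMaximal (Relevant S 𝒫) 𝒫 (swap s)

  ConsistentOrientation : Pred (Sep n) 0ℓ → Pred (SepSet n) 0ℓ
  ConsistentOrientation N O = Orients ⟦ O ⟧ N × Consistent ⟦ O ⟧

  -- S_O, where O is an orientation of N
  restrictS : Pred (Sep n) 0ℓ → Pred (Sep n) 0ℓ → SepSet n → Pred (Sep n) 0ℓ
  restrictS S N O s =
    s ∈ S × NestedWithAll N s ×
    Consistent (⟦ O ⟧ ∪ᵖ ｛ s ｝) × Consistent (⟦ O ⟧ ∪ᵖ ｛ swap s ｝)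

  -- {P ∈ 𝒫 : O ⊆ P}
  extending : Pred (SepSet n) 0ℓ → SepSet n → Pred (SepSet n) 0ℓ
  extending 𝒫 O P = P ∈ 𝒫 × ⟦ O ⟧ ⊆ ⟦ P ⟧

  -- N_Σ(S , 𝒫), as the least set satisfying the recursion: empty if there is
  -- no relevant separation, and otherwise σ(S , 𝒫) together with the sets
  -- N_Σ(S_O , 𝒫_O) for all consistent orientations O of σ(S , 𝒫).  Since
  -- S_O is disjoint from σ(S , 𝒫), the recursion can fail to descend only on
  -- a task with σ(S , 𝒫) = ∅.
  data StrategySet (σ : Selector n) (S : Pred (Sep n) 0ℓ) (𝒫 : Pred (SepSet n) 0ℓ)
                   (s : Sep n) : Set where
    select  : Satisfiable (Relevant S 𝒫) → s ∈ σ S 𝒫 → StrategySet σ S 𝒫 s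
    recurse : Satisfiable (Relevant S 𝒫) →
              (O : SepSet n) → O ∈ ConsistentOrientation (σ S 𝒫) →
              StrategySet σ (restrictS S (σ S 𝒫) O) (extending 𝒫 O) s →
              StrategySet σ S 𝒫 s

module _ {n : ℕ} (G : Graph n) where
  open Graph G

  IsSeparation : Pred (Sep n) 0ℓ
  IsSeparation (A , B) =
    A ∪ B ≡ ⊤ × (∀ {u v} → u ∈ᵥ A ─ B → v ∈ᵥ B ─ A → ¬ Adj u v)

  IsProfile : ℕ → Pred (SepSet n) 0ℓ
  IsProfile k = IsProfileOf (λ s → IsSeparation s × order s < k)

  -- 𝒫_ℓ for a set 𝒫 of k-profiles; 𝒫_0 = {∅} even if 𝒫 is empty.
  profilesAt : Pred (SepSet n) 0ℓ → ℕ → Pred (SepSet n) 0ℓ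
  profilesAt 𝒫 zero    Q = ⟦ Q ⟧ ⊆ ∅
  profilesAt 𝒫 (suc ℓ) Q = Q ∈ IsProfile (suc ℓ) × (∃[ P ] P ∈ 𝒫 × ⟦ Q ⟧ ⊆ ⟦ P ⟧)

  -- For N = N_ℓ this is S^(ℓ+1).
  systemAt : ℕ → Pred (Sep n) 0ℓ → Pred (Sep n) 0ℓ
  systemAt ℓ N s = IsSeparation s × Proper s × order s ≡ ℓ × NestedWithAll N s

  -- The sets N_ℓ of the strategy all of whose entries are given by σ.
  iterated : Selector n → Pred (SepSet n) 0ℓ → ℕ → Pred (Sep n) 0ℓ
  iterated σ 𝒫 zero      = ∅
  iterated σ 𝒫 (suc ℓ) s =
    s ∈ iterated σ 𝒫 ℓ ⊎
    (∃[ P ] P ∈ profilesAt 𝒫 ℓ ×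
            s ∈ StrategySet σ (systemAt ℓ (iterated σ 𝒫 ℓ))
                              (extending (profilesAt 𝒫 (suc ℓ)) P))

  N-Ext : ℕ → Pred (SepSet n) 0ℓ → Pred (Sep n) 0ℓ
  N-Ext k 𝒫 = iterated extᵣ 𝒫 k

  N-Loc : ℕ → Pred (SepSet n) 0ℓ → Pred (Sep n) 0ℓ
  N-Loc k 𝒫 = iterated locᵣ 𝒫 k

  -- X separates G if some two vertices outside X are not joined by a path
  -- in G - X.
  Separates : Pred (Subset n) 0ℓ
  Separates X =
    ∃[ u ] ∃[ v ] u ∉ᵥ X × v ∉ᵥ X ×
      ¬ Star (λ x y → Adj x y × x ∉ᵥ X × y ∉ᵥ X) u v

  Connected : ℕ → Set
  Connected j = j < n × (∀ X → ∣ X ∣ < j → ¬ Separates X)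

{-# OPTIONS --safe #-}
module Submission where

open import Data.Bool.Base using (Bool; true; false; T; _∧_)
open import Data.Bool.Properties using (T?)
import Data.Bool.Properties as Bool
open import Data.Empty using (⊥-elim)
open import Data.Fin.Base using (Fin; zero; suc)
import Data.Fin.Properties as Fin
open import Data.Fin.Subset using (Subset; inside; outside; ⊤; ∣_∣; _∩_; _∪_; _─_)
  renaming (_∈_ to _∈ᵥ_; _∉_ to _∉ᵥ_; _⊆_ to _⊆ᵥ_)
import Data.Fin.Subset.Properties as Subset
open import Data.List.Base 
  using (List; []; _∷_; _++_; map; filter; length; deduplicate; tabulate; lookup; cartesianProduct)
open import Data.List.Membership.Propositional using (lose; find) renaming (_∈_ to _∈ˡ_)
open import Data.List.Membership.Propositional.Properties
  using (∈-++⁺ˡ; ∈-++⁺ʳ; ∈-++⁻; ∈-map⁺; ∈-map⁻; ∈-filter⁺; ∈-filter⁻;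
         ∈-cartesianProduct⁺; ∈-deduplicate⁺; ∈-deduplicate⁻; ∈-tabulate⁺; ∈-tabulate⁻; ∈-lookup)
open import Data.List.Properties using (length-++; length-map; length-filter; filter-notAll; length-tabulate)
open import Data.List.Relation.Unary.All as All using (All; []; _∷_)
open import Data.List.Relation.Unary.AllPairs as AllPairs using (AllPairs; []; _∷_)
import Data.List.Relation.Unary.AllPairs.Properties as AllPairs
open import Data.List.Relation.Unary.Any as Any using (here; there)
open import Data.List.Relation.Unary.Any.Properties using (lookup-index)
open import Data.Nat.ListAction using (sum)
open import Data.Nat.Base using (ℕ; zero; suc; _+_; _*_; _∸_; _≤_; _<_; z≤n; s≤s; s≤s⁻¹)
open import Data.Nat.Properties
open import Data.Product.Base using (_×_; _,_; ∃-syntax; proj₁; proj₂; swap)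
open import Data.Product.Properties using (≡-dec)
open import Data.Sum.Base as Sum using (_⊎_; inj₁; inj₂; [_,_]′)
import Data.Vec.Properties as Vec
open import Data.Vec.Base using ([]; _∷_; there)
open import Function.Base using (_∘_; id; case_of_)
open import Function.Definitions using (Injective)
open import Level using (0ℓ)
open import Relation.Binary.Construct.Closure.ReflexiveTransitive using (Star; ε; _◅_)
open import Relation.Binary.PropositionalEquality
  using (_≡_; _≢_; _≗_; refl; sym; trans; cong; cong₂; subst)
open import Relation.Nullary using (Dec; yes; no; ¬_; ¬?; contradiction)
open import Relation.Nullary.Decidable using (map′; _×-dec_; _⊎-dec_; ⌊_⌋; decidable-stable)
open import Relation.Unary using (Pred; Decidable; _∈_; _∉_; _⊆_; _≐_; ∅; U; Satisfiable; ｛_｝)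
  renaming (_∪_ to _∪ᵖ_; _∩_ to _∩ᵖ_)
open import Defs

-- A locally maximal separation is nested with every relevant one, so the
-- recursion never loses a separation distinguishing two profiles that agree on
-- the selected set N, and by feasibility N is nonempty while there are relevant
-- separations.  Across levels, a separation distinguishing two profiles can be
-- moved to a corner until it is nested with everything selected so far, since
-- each selected separation distinguishes some two profiles with least order.
-- Hence the final set is nested and distinguishes the p profiles; as the edge
-- set of a tree in which they live at distinct nodes it has at least 2(p − 1)
-- elements.  For the upper bound let q be the number of classes into which N
-- splits the profiles of a task.  In the tree of N every edge has an end at a
-- profile, so edges can be assigned at most 2-to-1 to profiles other than a
-- root, and |N| ≤ 4(q − 1); these bounds add up to 4(p − 1) over the recursion.
-- For Ext each extremal separation uses up a profile of its own, which bounds a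
-- single level by 2p; if G is (k − 1)-connected only the last level contributes.

-- Counting in lists

-- Sets of separations are bare predicates, so neither membership in a strategy set nor its
-- cardinality is given in advance. A task therefore carries a list of its profiles; the length of
-- that list is both the measure of the recursion and the quantity in which the upper bounds are
-- stated. The recursion never mentions orders: all it needs of the graph is the field `feasible`,
-- by which crossing separations that tell the same two profiles apart in the same direction have an
-- upper bound doing so too, and which passes to every branch. The bound 4(q - 1) is kept in the
-- form `length xs + 4 ≤ 4 * q`. Summed over q branches it leaves a surplus of 4q, exactly what the
-- bound for the selected set consumes, so the inequalities telescope; the levels are added up in
-- the same way. In this form the bound fails for a task without profiles. Hence the care for
-- nonempty lists, and the separate treatment of empty 𝒫, where 𝒫₀ still has the element ∅.

private
  variable
    A B : Set

remove : ∀ {y : A} {ys} → y ∈ˡ ys →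
         ∃[ zs ] length ys ≡ suc (length zs) × (∀ {z} → z ∈ˡ ys → z ≡ y ⊎ z ∈ˡ zs)
remove {ys = _ ∷ ys} (here refl) = ys , refl , λ { (here e) → inj₁ e ; (there m) → inj₂ m }
remove {ys = y ∷ _} (there m) with remove m
... | zs , eq , f =
  y ∷ zs , cong suc eq , λ { (here e) → inj₂ (here e) ; (there m′) → Sum.map₂ there (f m′) }

-- Targets are given by a relation, and injectivity says that two entries never share one; so the
-- target taken by the head can be deleted from `ys` before the tail is treated.
pigeonhole : {F : A → B → Set} (xs : List A) (ys : List B) →
             (∀ {x} → x ∈ˡ xs → ∃[ y ] y ∈ˡ ys × F x y) →
             AllPairs (λ x x′ → ∀ {y} → F x y → ¬ F x′ y) xs →
             length xs ≤ length ys
pigeonhole [] ys f [] = z≤n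
pigeonhole {F = F} (x ∷ xs) ys f (ne ∷ ap) with f (here refl)
... | y , y∈ , Fxy with remove y∈
... | zs , eq , g = subst (suc (length xs) ≤_) (sym eq) (s≤s (pigeonhole xs zs f′ ap))
  where
  f′ : ∀ {x′} → x′ ∈ˡ xs → ∃[ y′ ] y′ ∈ˡ zs × F x′ y′
  f′ m with f (there m)
  ... | y′ , y′∈ , Fx′y′ with g y′∈
  ... | inj₁ refl = ⊥-elim (All.lookup ne m Fxy Fx′y′)
  ... | inj₂ y′∈zs = y′ , y′∈zs , Fx′y′

unique-⊆⇒length≤ : {xs ys : List A} → AllPairs _≢_ xs → (∀ {x} → x ∈ˡ xs → x ∈ˡ ys) →
                   length xs ≤ length ys
unique-⊆⇒length≤ {xs = xs} {ys} u inc =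
  pigeonhole {F = _≡_} xs ys (λ {x} m → x , inc m , refl)
    (AllPairs.map (λ ne → λ { refl refl → ne refl }) u)

DisjointOn : (A → B → Set) → List B → A → A → Set
DisjointOn R ys x x′ = ∀ {y} → y ∈ˡ ys → R x y → ¬ R x′ y

module _ {R : A → B → Set} (R? : ∀ x y → Dec (R x y)) where

  private
    #_ : List B → A → ℕ
    (# ys) x = length (filter (R? x) ys)

    none : ∀ {y ys} xs → All (λ x → ¬ R x y) xs → sum (map (# (y ∷ ys)) xs) ≡ sum (map (# ys) xs)
    none [] [] = refl
    none {y} (x ∷ xs) (nr ∷ nrs) with R? x y
    ... | yes r = contradiction r nr
    ... | no _ = cong (_ +_) (none xs nrs)

    atMostOne : ∀ {y ys} xs → AllPairs (DisjointOn R (y ∷ ys)) xs →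
                sum (map (# (y ∷ ys)) xs) ≤ suc (sum (map (# ys) xs))
    atMostOne [] [] = z≤n
    atMostOne {y} {ys} (x ∷ xs) (ne ∷ ap) with R? x y
    ... | yes r = s≤s (+-monoʳ-≤ ((# ys) x) (≤-reflexive (none xs (All.map (λ f → f (here refl) r) ne))))
    ... | no _ = ≤-trans (+-monoʳ-≤ ((# ys) x) (atMostOne xs ap)) (≤-reflexive (+-suc _ _))

    zeros : ∀ xs → sum (map (# []) xs) ≡ 0
    zeros [] = refl
    zeros (_ ∷ xs) = zeros xs

  -- Peeling off one entry of `ys` lowers the sum by at most one, because at most one row counts it.
  -- Pairwise incompatible orientations thus pick parts of a list of profiles whose lengths add up
  -- to at most that of the list.
  sum-length-filter≤ : ∀ xs ys → AllPairs (DisjointOn R ys) xs →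
                       sum (map (λ x → length (filter (R? x) ys)) xs) ≤ length ys
  sum-length-filter≤ xs [] ap = ≤-reflexive (zeros xs)
  sum-length-filter≤ xs (y ∷ ys) ap =
    ≤-trans (atMostOne xs ap) (s≤s (sum-length-filter≤ xs ys (AllPairs.map (λ f {y} m → f {y} (there m)) ap)))

-- Two predicates enclose the list so that one lemma yields exact enumerations (`c` = `d` = 4) and
-- mere covers (`c` = 2, `d` = 0). The surplus `d` of every entry is kept, to be spent on
-- separations selected earlier.
collect : {F F′ : A → Pred B 0ℓ} (w : A → ℕ) (c d : ℕ) (xs : List A) →
          (∀ {x} → x ∈ˡ xs → ∃[ ys ] ((_∈ˡ ys) ⊆ F x × F′ x ⊆ (_∈ˡ ys)) × length ys + d ≤ c * w x) →
          ∃[ zs ] ((_∈ˡ zs) ⊆ (λ s → ∃[ x ] x ∈ˡ xs × F x s) ×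
                   (λ s → ∃[ x ] x ∈ˡ xs × F′ x s) ⊆ (_∈ˡ zs)) ×
                  length zs + d * length xs ≤ c * sum (map w xs)
collect w c d [] f =
  [] , ((λ ()) , (λ { (_ , () , _) })) , ≤-trans (≤-reflexive (*-zeroʳ d)) z≤n
collect {F = F} {F′} w c d (x ∷ xs) f with f (here refl) | collect {F = F} {F′} w c d xs (f ∘ there)
... | ys , (snd , cmp) , b | zs , (snd′ , cmp′) , b′ =
  ys ++ zs ,
  ((λ m → [ (λ m′ → x , here refl , snd m′)
          , (λ m′ → case snd′ m′ of λ { (x′ , x′∈ , Fx′) → x′ , there x′∈ , Fx′ }) ]′ (∈-++⁻ ys m))
  , λ { (_ , here refl , Fx) → ∈-++⁺ˡ (cmp Fx)
      ; (x′ , there m , Fx) → ∈-++⁺ʳ ys (cmp′ (x′ , m , Fx)) }) ,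
  bound
  where
  open ≤-Reasoning
  bound : length (ys ++ zs) + d * suc (length xs) ≤ c * (w x + sum (map w xs))
  bound = begin
    length (ys ++ zs) + d * suc (length xs)            ≡⟨ cong₂ _+_ (length-++ ys) (*-suc d (length xs)) ⟩
    (length ys + length zs) + (d + d * length xs)      ≡⟨ +-assoc (length ys) _ _ ⟩
    length ys + (length zs + (d + d * length xs))      ≡⟨ cong (length ys +_) (+-comm (length zs) _) ⟩
    length ys + ((d + d * length xs) + length zs)      ≡⟨ cong (length ys +_) (+-assoc d _ _) ⟩
    length ys + (d + (d * length xs + length zs))      ≡⟨ +-assoc (length ys) d _ ⟨
    (length ys + d) + (d * length xs + length zs)      ≡⟨ cong ((length ys + d) +_) (+-comm (d * length xs) _) ⟩
    (length ys + d) + (length zs + d * length xs)      ≤⟨ +-mono-≤ b b′ ⟩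
    c * w x + c * sum (map w xs)                       ≡⟨ *-distribˡ-+ c (w x) _ ⟨
    c * (w x + sum (map w xs))                         ∎

-- The bounds telescope at `q`, which will be four times the number of classes of a task or of
-- profiles of the level below.
length-++-bound : ∀ {m q b} (ys zs : List A) → length ys + m ≤ q → length zs + q ≤ b →
                  length (ys ++ zs) + m ≤ b
length-++-bound {m = m} {q} {b} ys zs ys≤ zs≤ = begin
  length (ys ++ zs) + m        ≡⟨ cong (_+ m) (trans (length-++ ys) (+-comm (length ys) _)) ⟩
  length zs + length ys + m    ≡⟨ +-assoc (length zs) _ m ⟩
  length zs + (length ys + m)  ≤⟨ +-monoʳ-≤ (length zs) ys≤ ⟩
  length zs + q                ≤⟨ zs≤ ⟩
  b                            ∎
  where open ≤-Reasoning

module _ {R : A → A → Set} (R? : ∀ x y → Dec (R x y)) where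

  deduplicate-distinct : ∀ xs → AllPairs (λ x y → ¬ R x y) (deduplicate R? xs)
  deduplicate-distinct [] = []
  deduplicate-distinct (x ∷ xs) =
    All.tabulate (λ m → proj₂ (∈-filter⁻ (¬? ∘ R? x) {xs = deduplicate R? xs} m)) ∷
    AllPairs.filter⁺ (¬? ∘ R? x) (deduplicate-distinct xs)

  deduplicate-represents : (∀ {x} → R x x) → (∀ {x y z} → R x y → R y z → R x z) →
                           ∀ {xs y} → y ∈ˡ xs → ∃[ x ] x ∈ˡ deduplicate R? xs × R x y
  deduplicate-represents rf tr {x ∷ xs} (here refl) = x , here refl , rf
  deduplicate-represents rf tr {x ∷ xs} (there m) with deduplicate-represents rf tr m
  ... | z , z∈ , Rzy with R? x z
  ... | yes Rxz = x , here refl , tr Rxz Rzy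
  ... | no ¬Rxz = z , there (∈-filter⁺ (¬? ∘ R? x) z∈ ¬Rxz) , Rzy

  length-deduplicate≤ : ∀ xs → length (deduplicate R? xs) ≤ length xs
  length-deduplicate≤ [] = z≤n
  length-deduplicate≤ (x ∷ xs) =
    s≤s (≤-trans (length-filter (¬? ∘ R? x) (deduplicate R? xs)) (length-deduplicate≤ xs))

-- Finite quantification over separations

allSubsets : ∀ n → List (Subset n)
allSubsets zero = [] ∷ []
allSubsets (suc n) = map (inside ∷_) (allSubsets n) ++ map (outside ∷_) (allSubsets n)

∈-allSubsets : ∀ {n} (p : Subset n) → p ∈ˡ allSubsets n
∈-allSubsets [] = here refl
∈-allSubsets (true ∷ p) = ∈-++⁺ˡ (∈-map⁺ (inside ∷_) (∈-allSubsets p))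
∈-allSubsets {suc n} (false ∷ p) =
  ∈-++⁺ʳ (map (inside ∷_) (allSubsets n)) (∈-map⁺ (outside ∷_) (∈-allSubsets p))

allSeps : ∀ n → List (Sep n)
allSeps n = cartesianProduct (allSubsets n) (allSubsets n)

∈-allSeps : ∀ {n} (s : Sep n) → s ∈ˡ allSeps n
∈-allSeps (A , B) = ∈-cartesianProduct⁺ (∈-allSubsets A) (∈-allSubsets B)

_≟ˢ_ : ∀ {n} (s t : Sep n) → Dec (s ≡ t)
_≟ˢ_ = ≡-dec (Vec.≡-dec Bool._≟_) (Vec.≡-dec Bool._≟_)

abstract
  module _ {n : ℕ} {X : Pred (Sep n) 0ℓ} (X? : Decidable X) where

    any-sep? : Dec (∃[ s ] s ∈ X)
    any-sep? = map′ Any.satisfied (λ { (s , Xs) → lose (∈-allSeps s) Xs }) (Any.any? X? (allSeps n))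

    all-seps? : Dec (∀ s → s ∈ X)
    all-seps? = map′ (λ a s → All.lookup a (∈-allSeps s)) (λ f → All.tabulate (λ {s} _ → f s))
                     (All.all? X? (allSeps n))

  ⊆-seps? : ∀ {n} {X Y : Pred (Sep n) 0ℓ} → Decidable X → Decidable Y → Dec (X ⊆ Y)
  ⊆-seps? {X = X} {Y} X? Y? = map′ (λ f {s} → to f s) (λ f s → from s f) (all-seps? (λ s → dec s))
    where
    dec : ∀ s → Dec (¬ X s ⊎ Y s)
    dec s = ¬? (X? s) ⊎-dec Y? s
    to : (∀ s → ¬ X s ⊎ Y s) → ∀ s → X s → Y s
    to f s Xs = [ (λ nx → contradiction Xs nx) , id ]′ (f s)
    from : ∀ s → (X ⊆ Y) → ¬ X s ⊎ Y s
    from s f with X? s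
    ... | yes Xs = inj₂ (f Xs)
    ... | no nx = inj₁ nx

-- The order on separations

module _ {n : ℕ} where

  private
    variable
      r s t u : Sep n
      X : Pred (Sep n) 0ℓ
      P Q : SepSet n

  ≼-refl : s ≼ s
  ≼-refl = id , id

  ≼-trans : r ≼ s → s ≼ t → r ≼ t
  ≼-trans (a , b) (c , d) = (λ x → c (a x)) , (λ x → b (d x))

  ≼-antisym : s ≼ t → t ≼ s → s ≡ t
  ≼-antisym (a , b) (c , d) = cong₂ _,_ (Subset.⊆-antisym a c) (Subset.⊆-antisym d b)

  ≼-swap : s ≼ t → swap t ≼ swap s
  ≼-swap (a , b) = b , a

  _≼?_ : (s t : Sep n) → Dec (s ≼ t)
  (A , B) ≼? (C , D) = (A Subset.⊆? C) ×-dec (D Subset.⊆? B)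

  nested? : (s t : Sep n) → Dec (Nested s t)
  nested? s t = ((s ≼? t) ⊎-dec (t ≼? s)) ⊎-dec ((s ≼? swap t) ⊎-dec (swap t ≼? s))

  nested-sym : Nested s t → Nested t s
  nested-sym (inj₁ c) = inj₁ (Sum.swap c)
  nested-sym (inj₂ (inj₁ a)) = inj₂ (inj₁ (≼-swap a))
  nested-sym (inj₂ (inj₂ a)) = inj₂ (inj₂ (≼-swap a))

  nested-swapʳ : Nested s t → Nested s (swap t)
  nested-swapʳ = Sum.swap

  nested-swapˡ : Nested s t → Nested (swap s) t
  nested-swapˡ = nested-sym ∘ nested-swapʳ ∘ nested-sym

  -- One pass that moves up whenever possible suffices: an entry not above the current element is
  -- not above any later, larger one.
  maximal-above : Decidable X → s ∈ X → ∃[ t ] s ≼ t × Maximal X t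
  maximal-above {X = X} {s = s} X? Xs = finish (go (allSeps n) Xs)
    where
    go : ∀ {s} xs → X s → ∃[ t ] s ≼ t × X t × (∀ {x} → x ∈ˡ xs → X x → t ≼ x → x ≼ t)
    go {s} [] Xs = s , ≼-refl , Xs , λ ()
    go {s} (x ∷ xs) Xs with X? x | s ≼? x
    ... | yes Xx | yes s≼x with go xs Xx
    ...   | t , x≼t , Xt , max = t , ≼-trans s≼x x≼t , Xt ,
              λ { (here refl) _ _ → x≼t ; (there m) → max m }
    go {s} (x ∷ xs) Xs | yes _ | no s⋠x with go xs Xs
    ...   | t , s≼t , Xt , max = t , s≼t , Xt ,
              λ { (here refl) _ t≼x → contradiction (≼-trans s≼t t≼x) s⋠x ; (there m) → max m }
    go {s} (x ∷ xs) Xs | no ¬Xx | _ with go xs Xs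
    ...   | t , s≼t , Xt , max = t , s≼t , Xt ,
              λ { (here refl) Xx _ → contradiction Xx ¬Xx ; (there m) → max m }
    finish : ∃[ t ] s ≼ t × X t × (∀ {x} → x ∈ˡ allSeps n → X x → t ≼ x → x ≼ t) →
             ∃[ t ] s ≼ t × Maximal X t
    finish (t , s≼t , Xt , max) =
      t , s≼t , Xt , λ {x} Xx t≼x → ≼-antisym (max (∈-allSeps x) Xx t≼x) t≼x

  maximal? : Decidable X → Decidable (Maximal X)
  maximal? {X = X} X? s = X? s ×-dec
    map′ (λ f {t} Xt s≼t → f t Xt s≼t) (λ f t → f {t}) (all-seps? λ t → imp? (X? t) (imp? (s ≼? t) (t ≟ˢ s)))
    where
    imp? : {C D : Set} → Dec C → Dec D → Dec (C → D)
    imp? (yes c) (yes d) = yes λ _ → d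
    imp? (yes c) (no ¬d) = no λ f → ¬d (f c)
    imp? (no ¬c) _ = yes λ c → contradiction c ¬c

  -- Unlike with `Orients`, Q may reach beyond X, so a profile serves unchanged as an orientation of
  -- every smaller system. That it contains only one of s and `swap s` follows from consistency.
  record Orientation (X : Pred (Sep n) 0ℓ) (Q : SepSet n) : Set where
    field
      oriented   : s ∈ X → s ∈ ⟦ Q ⟧ ⊎ swap s ∈ ⟦ Q ⟧
      consistent : Consistent ⟦ Q ⟧

    antisymmetric : s ∈ ⟦ Q ⟧ → swap s ∉ ⟦ Q ⟧
    antisymmetric s∈Q s*∈Q = consistent s∈Q s*∈Q ≼-refl

    downClosed : s ∈ X → s ≼ t → t ∈ ⟦ Q ⟧ → s ∈ ⟦ Q ⟧
    downClosed Xs s≼t t∈Q with oriented Xs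
    ... | inj₁ s∈Q = s∈Q
    ... | inj₂ s*∈Q = ⊥-elim (consistent s*∈Q t∈Q (≼-swap s≼t))

    complement : s ∈ X → s ∉ ⟦ Q ⟧ → swap s ∈ ⟦ Q ⟧
    complement Xs s∉Q with oriented Xs
    ... | inj₁ s∈Q = contradiction s∈Q s∉Q
    ... | inj₂ s*∈Q = s*∈Q

  open Orientation public

-- Counting separations in nested systems

Distinguishes : ∀ {n} → Pred (Sep n) 0ℓ → SepSet n → SepSet n → Set
Distinguishes X P Q = ∃[ s ] s ∈ X × s ∈ ⟦ P ⟧ × swap s ∈ ⟦ Q ⟧

abstract
  listOf : ∀ {n} {X : Pred (Sep n) 0ℓ} → Decidable X →
           ∃[ xs ] AllPairs _≢_ xs × (_∈ˡ xs) ≐ X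
  listOf {n} X? =
    deduplicate _≟ˢ_ (filter X? (allSeps n)) , deduplicate-distinct _≟ˢ_ _ ,
    (λ m → proj₂ (∈-filter⁻ X? {xs = allSeps n} (∈-deduplicate⁻ _≟ˢ_ (filter X? (allSeps n)) m))) ,
    (λ {s} Xs → ∈-deduplicate⁺ _≟ˢ_ (∈-filter⁺ X? (∈-allSeps s) Xs))

-- Rooting the tree of consistent orientations of N at P₀ directs every edge
-- {s , swap s} of the tree towards P₀; `Lower s P` says that P is the end of
-- the edge of s ∈ P₀ that is farther away from the root.
module NestedSystem
  {n : ℕ} {N : Pred (Sep n) 0ℓ} (N? : Decidable N)
  (N-nested : ∀ {s t} → s ∈ N → t ∈ N → Nested s t)
  (N-swap : ∀ {s} → s ∈ N → swap s ∈ N)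
  {P₀ : SepSet n} (o₀ : Orientation N P₀) (Ps : List (SepSet n))
  (os : ∀ {P} → P ∈ˡ Ps → Orientation N P)
  where

  private
    variable
      s t u : Sep n
      P Q : SepSet n

  Lower : Sep n → SepSet n → Set
  Lower s P = swap s ∈ Maximal (⟦ P ⟧ ∩ᵖ N)

  private
    towardsRoot : ∃[ xs ] AllPairs _≢_ xs × (_∈ˡ xs) ≐ (⟦ P₀ ⟧ ∩ᵖ N)
    towardsRoot = listOf (λ s → T? (P₀ s) ×-dec N? s)

    xs₀ : List (Sep n)
    xs₀ = proj₁ towardsRoot

    xs₀-unique : AllPairs _≢_ xs₀
    xs₀-unique = proj₁ (proj₂ towardsRoot)

    xs₀-sound : s ∈ˡ xs₀ → s ∈ ⟦ P₀ ⟧ × s ∈ N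
    xs₀-sound = proj₁ (proj₂ (proj₂ towardsRoot))

    xs₀-complete : s ∈ ⟦ P₀ ⟧ → s ∈ N → s ∈ˡ xs₀
    xs₀-complete a b = proj₂ (proj₂ (proj₂ towardsRoot)) (a , b)

    _∩N? : (P : SepSet n) → Decidable (⟦ P ⟧ ∩ᵖ N)
    (P ∩N?) s = T? (P s) ×-dec N? s

    -- An orientation is determined on N by any one of its maximal elements: up to inversion,
    -- everything in N lies below that element, where down-closure forces the orientation, or above
    -- it, where maximality does.
    Lower-agree : Orientation N P → Orientation N Q → Lower s P → Lower s Q →
                  ¬ Distinguishes N P Q
    Lower-agree oP oQ ((s*∈P , Ns*) , maxP) ((s*∈Q , _) , maxQ) (t , Nt , t∈P , t*∈Q)
      with N-nested Nt Ns*
    ... | inj₁ (inj₁ t≼s*) = antisymmetric oQ (downClosed oQ Nt t≼s* s*∈Q) t*∈Q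
    ... | inj₁ (inj₂ s*≼t) with maxP (t∈P , Nt) s*≼t
    ...   | refl = antisymmetric oQ s*∈Q t*∈Q
    Lower-agree oP oQ ((s*∈P , Ns*) , maxP) ((s*∈Q , _) , maxQ) (t , Nt , t∈P , t*∈Q)
        | inj₂ (inj₁ t≼s) with maxQ (t*∈Q , N-swap Nt) (≼-swap t≼s)
    ...   | refl = antisymmetric oP t∈P s*∈P
    Lower-agree oP oQ ((s*∈P , Ns*) , maxP) ((s*∈Q , _) , maxQ) (t , Nt , t∈P , t*∈Q)
        | inj₂ (inj₂ s≼t) = antisymmetric oP t∈P (downClosed oP (N-swap Nt) (≼-swap s≼t) s*∈P)

  -- The edge assigned to P is the last one on the path to it from the root: a maximal element of P
  -- above one that distinguishes P from `P₀` cannot lie in `P₀`. By `Lower-agree` profiles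
  -- distinguished by N get different edges. `xs₀` holds one separation per edge, whence the factor
  -- 2.
  2*length≤ : AllPairs (Distinguishes N) (P₀ ∷ Ps) →
              ∀ {xs} → N ⊆ (_∈ˡ xs) → 2 * length Ps ≤ length xs
  2*length≤ (d₀ ∷ ds) {xs} inc = begin
    2 * length Ps                  ≤⟨ *-monoʳ-≤ 2 (pigeonhole {F = F} Ps xs₀ top inj) ⟩
    2 * length xs₀                 ≡⟨ cong (length xs₀ +_) (+-identityʳ _) ⟩
    length xs₀ + length xs₀        ≡⟨ cong (length xs₀ +_) (length-map swap xs₀) ⟨
    length xs₀ + length (map swap xs₀) ≡⟨ length-++ xs₀ ⟨
    length (xs₀ ++ map swap xs₀)   ≤⟨ unique-⊆⇒length≤ unique inc′ ⟩
    length xs                      ∎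
    where
    open ≤-Reasoning
    F : SepSet n → Sep n → Set
    F P s = P ∈ˡ Ps × Lower s P
    top : P ∈ˡ Ps → ∃[ s ] s ∈ˡ xs₀ × F P s
    top {P} m with All.lookup d₀ m
    ... | r , Nr , r∈P₀ , r*∈P with maximal-above (P ∩N?) (r*∈P , N-swap Nr)
    ... | t , r*≼t , max@((t∈P , Nt) , _) =
      swap t , xs₀-complete (complement o₀ Nt t∉P₀) (N-swap Nt) , m , max
      where
      t∉P₀ : t ∉ ⟦ P₀ ⟧
      t∉P₀ t∈P₀ = antisymmetric o₀ r∈P₀ (downClosed o₀ (N-swap Nr) r*≼t t∈P₀)
    inj : AllPairs (λ P Q → ∀ {s} → F P s → ¬ F Q s) Ps
    inj = AllPairs.map (λ d → λ { (m , l) (m′ , l′) → Lower-agree (os m) (os m′) l l′ d }) ds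
    unique : AllPairs _≢_ (xs₀ ++ map swap xs₀)
    unique = AllPairs.++⁺ xs₀-unique
      (AllPairs.map⁺ (AllPairs.map (λ ne e → ne (cong swap e)) xs₀-unique))
      (All.tabulate λ m → All.tabulate λ m′ → separate m m′)
      where
      separate : s ∈ˡ xs₀ → t ∈ˡ map swap xs₀ → s ≢ t
      separate m m′ refl with ∈-map⁻ swap m′
      ... | u , u∈ , refl = antisymmetric o₀ (proj₁ (xs₀-sound u∈)) (proj₁ (xs₀-sound m))
    inc′ : s ∈ˡ xs₀ ++ map swap xs₀ → s ∈ˡ xs
    inc′ m with ∈-++⁻ xs₀ m
    ... | inj₁ m′ = inc (proj₂ (xs₀-sound m′))
    ... | inj₂ m′ with ∈-map⁻ swap m′
    ...   | u , u∈ , refl = inc (N-swap (proj₂ (xs₀-sound u∈)))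

  private
    Below : Sep n → Pred (Sep n) 0ℓ
    Below s t = t ∈ N × t ≼ s × t ≢ s

    below? : Decidable (Below s)
    below? {s} t = N? t ×-dec (t ≼? s) ×-dec ¬? (t ≟ˢ s)

    -- A node has only one edge towards the root: if `swap s` and `swap t` were incomparable,
    -- nestedness would contradict the consistency of `P₀` or of P.
    lower-unique : P ∈ˡ Ps → s ∈ ⟦ P₀ ⟧ → t ∈ ⟦ P₀ ⟧ → Lower s P → Lower t P → s ≡ t
    lower-unique m s∈ t∈ ((s*∈P , Ns*) , maxs) ((t*∈P , Nt*) , maxt) with N-nested Ns* Nt*
    ... | inj₁ (inj₁ a) = sym (cong swap (maxs (t*∈P , Nt*) a))
    ... | inj₁ (inj₂ a) = cong swap (maxt (s*∈P , Ns*) a)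
    ... | inj₂ (inj₁ a) = ⊥-elim (consistent o₀ t∈ s∈ a)
    ... | inj₂ (inj₂ a) = ⊥-elim (consistent (os m) s*∈P t*∈P a)

    -- The maximal elements of `Below s` are the child edges of s, and a child edge has only one
    -- parent. For distinct s and t, comparability contradicts maximality, `swap t ≼ s` contradicts
    -- consistency, and `s ≼ swap t` would put u below its own inverse.
    maximal-below-unique : Maximal (Below s) u → Maximal (Below t) u →
                           s ∈ ⟦ P₀ ⟧ → t ∈ ⟦ P₀ ⟧ → s ∈ N → t ∈ N → ¬ (u ≼ swap u) → s ≡ t
    maximal-below-unique {s} {u} {t} ((Nu , u≼s , u≢s) , maxs) ((_ , u≼t , u≢t) , maxt) s∈ t∈ Ns Nt u≁
      with s ≟ˢ t
    ... | yes e = e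
    ... | no s≢t with N-nested Ns Nt
    ...   | inj₁ (inj₁ s≼t) = ⊥-elim (u≢s (sym (maxt (Ns , s≼t , s≢t) u≼s)))
    ...   | inj₁ (inj₂ t≼s) = ⊥-elim (u≢t (sym (maxs (Nt , t≼s , s≢t ∘ sym) u≼t)))
    ...   | inj₂ (inj₁ s≼t*) = ⊥-elim (u≁ (≼-trans u≼s (≼-trans s≼t* (≼-swap u≼t))))
    ...   | inj₂ (inj₂ t*≼s) = ⊥-elim (consistent o₀ s∈ t∈ t*≼s)

  -- A hub, that is, a consistent orientation of N induced by no P, has a
  -- child, and the lower end of the edge to it is not a hub.  So mapping the
  -- edge above a hub to the lower end of an edge below it, and any other edge
  -- to its own lower end, is at most 2-to-1.
  length≤4*length : (∀ {s} → s ∈ N → ¬ (s ≼ swap s)) →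
                    (∀ {s} → s ∈ N → ∃[ P ] P ∈ˡ P₀ ∷ Ps × s ∈ ⟦ P ⟧) →
                    (∀ {s} → s ∈ N → ∃[ P ] P ∈ˡ P₀ ∷ Ps ×
                       (s ∈ Maximal (⟦ P ⟧ ∩ᵖ N) ⊎ swap s ∈ Maximal (⟦ P ⟧ ∩ᵖ N))) →
                    ∃[ xs ] (_∈ˡ xs) ≐ N × length xs + 4 ≤ 4 * length (P₀ ∷ Ps)
  length≤4*length proper contained locmax = xs₀ ++ map swap xs₀ , (sound , complete) , bound
    where
    nonroot : s ∈ ⟦ P₀ ⟧ → swap s ∈ ⟦ P ⟧ → P ∈ˡ P₀ ∷ Ps → P ∈ˡ Ps
    nonroot s∈ s*∈ (here refl) = ⊥-elim (antisymmetric o₀ s∈ s*∈)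
    nonroot s∈ s*∈ (there m) = m

    orientation : P ∈ˡ P₀ ∷ Ps → Orientation N P
    orientation (here refl) = o₀
    orientation (there m) = os m

    -- Every profile can receive two edges: `true` marks its own edge towards the root, `false` the
    -- parent of that edge.
    F : Sep n → SepSet n × Bool → Set
    F s (P , true) = P ∈ˡ Ps × s ∈ ⟦ P₀ ⟧ × s ∈ N × Lower s P
    F s (P , false) = P ∈ˡ Ps × s ∈ ⟦ P₀ ⟧ × s ∈ N ×
                      (∃[ t ] t ∈ ⟦ P₀ ⟧ × Lower t P × Maximal (Below s) t)

    ys : List (SepSet n × Bool)
    ys = map (_, true) Ps ++ map (_, false) Ps

    F∈ys : ∀ {b} → F s (P , b) → ∃[ y ] y ∈ˡ ys × F s y
    F∈ys {P = P} {b = true} f@(m , _) = (P , true) , ∈-++⁺ˡ (∈-map⁺ (_, true) m) , f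
    F∈ys {P = P} {b = false} f@(m , _) = (P , false) , ∈-++⁺ʳ (map (_, true) Ps) (∈-map⁺ (_, false) m) , f

    lowerOrBelow : s ∈ ⟦ P₀ ⟧ → s ∈ N → P ∈ˡ P₀ ∷ Ps → swap s ∈ ⟦ P ⟧ →
                   Lower s P ⊎ ∃[ t ] swap t ∈ Maximal (⟦ P ⟧ ∩ᵖ N) × Below s t
    lowerOrBelow {s} {P} s∈ Ns m s*∈P with maximal-above (P ∩N?) (s*∈P , N-swap Ns)
    ... | u , s*≼u , max@((u∈P , Nu) , _) with u ≟ˢ swap s
    ...   | yes refl = inj₁ max
    ...   | no ne = inj₂ (swap u , max , N-swap Nu , ≼-swap s*≼u , λ e → ne (cong swap e))

    target : s ∈ˡ xs₀ → ∃[ y ] y ∈ˡ ys × F s y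
    target {s} s∈xs with xs₀-sound s∈xs
    ... | s∈ , Ns with contained (N-swap Ns)
    ... | P , P∈ , s*∈P with lowerOrBelow s∈ Ns P∈ s*∈P
    ... | inj₁ low = F∈ys {b = true} (nonroot s∈ s*∈P P∈ , s∈ , Ns , low)
    ... | inj₂ (t , _ , below-t) with maximal-above below? below-t
    -- The child edge u of s has a profile Q at one of its ends. If that is the far end, Q receives
    -- s with the tag `false`.
    ... | u , _ , maxu@((Nu , u≼s , u≢s) , bmax) with downClosed o₀ Nu u≼s s∈ | locmax Nu
    ... | u∈ | Q , Q∈ , inj₂ low =
      F∈ys {b = false} (nonroot u∈ (proj₁ (proj₁ low)) Q∈ , s∈ , Ns , u , u∈ , low , maxu)
    -- At the near end, u is maximal in Q, and Q is also the far end of s: otherwise there would be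
    -- some v below s with `swap v` maximal in Q, which could be nested with u in no way.
    ... | u∈ | Q , Q∈ , inj₁ ((u∈Q , _) , max) with complement (orientation Q∈) Ns (λ s∈Q → u≢s (sym (max (s∈Q , Ns) u≼s)))
    ...   | s*∈Q with lowerOrBelow s∈ Ns Q∈ s*∈Q
    ...   | inj₁ low = F∈ys {b = true} (nonroot s∈ s*∈Q Q∈ , s∈ , Ns , low)
    ...   | inj₂ (v , ((v*∈Q , Nv*) , vmax) , below-v@(Nv , v≼s , v≢s)) = ⊥-elim (absurd (N-nested Nv Nu))
      where
      oQ = orientation Q∈
      v∈ = downClosed o₀ Nv v≼s s∈
      absurd : ¬ Nested v u
      absurd (inj₁ (inj₁ v≼u)) = antisymmetric oQ (downClosed oQ Nv v≼u u∈Q) v*∈Q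
      absurd (inj₁ (inj₂ u≼v)) with bmax below-v u≼v
      ... | refl = antisymmetric oQ u∈Q v*∈Q
      absurd (inj₂ (inj₁ v≼u*)) with max (v*∈Q , Nv*) (≼-swap v≼u*)
      ... | refl = antisymmetric o₀ v∈ u∈
      absurd (inj₂ (inj₂ u*≼v)) = consistent o₀ v∈ u∈ u*≼v

    F-injective : ∀ {y} → F s y → F t y → s ≡ t
    F-injective {y = _ , true} (m , s∈ , _ , ls) (_ , t∈ , _ , lt) = lower-unique m s∈ t∈ ls lt
    F-injective {y = _ , false} (m , s∈ , Ns , u , u∈ , lu , mu) (_ , t∈ , Nt , v , v∈ , lv , mv)
      with lower-unique m u∈ v∈ lu lv
    ... | refl = maximal-below-unique mu mv s∈ t∈ Ns Nt (proper (proj₁ (proj₁ mu)))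

    sound : s ∈ˡ xs₀ ++ map swap xs₀ → s ∈ N
    sound m with ∈-++⁻ xs₀ m
    ... | inj₁ m′ = proj₂ (xs₀-sound m′)
    ... | inj₂ m′ with ∈-map⁻ swap m′
    ...   | u , u∈ , refl = N-swap (proj₂ (xs₀-sound u∈))

    complete : s ∈ N → s ∈ˡ xs₀ ++ map swap xs₀
    complete {s} Ns with oriented o₀ Ns
    ... | inj₁ s∈ = ∈-++⁺ˡ (xs₀-complete s∈ Ns)
    ... | inj₂ s*∈ = ∈-++⁺ʳ xs₀ (∈-map⁺ swap (xs₀-complete s*∈ (N-swap Ns)))

    open ≤-Reasoning
    xs₀≤ : length xs₀ ≤ 2 * length Ps
    xs₀≤ = begin
      length xs₀  ≤⟨ pigeonhole {F = F} xs₀ ys target (AllPairs.map (λ ne {y} f f′ → ne (F-injective {y = y} f f′)) xs₀-unique) ⟩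
      length ys   ≡⟨ length-++ (map (_, true) Ps) ⟩
      length (map (_, true) Ps) + length (map (_, false) Ps) ≡⟨ cong₂ _+_ (length-map _ Ps) (length-map _ Ps) ⟩
      length Ps + length Ps  ≡⟨ cong (length Ps +_) (+-identityʳ _) ⟨
      2 * length Ps ∎

    bound : length (xs₀ ++ map swap xs₀) + 4 ≤ 4 * suc (length Ps)
    bound = begin
      length (xs₀ ++ map swap xs₀) + 4 ≡⟨ cong (_+ 4) (length-++ xs₀) ⟩
      length xs₀ + length (map swap xs₀) + 4 ≡⟨ cong (λ m → length xs₀ + m + 4) (length-map swap xs₀) ⟩
      length xs₀ + length xs₀ + 4 ≤⟨ +-monoˡ-≤ 4 (+-mono-≤ xs₀≤ xs₀≤) ⟩
      2 * length Ps + 2 * length Ps + 4 ≡⟨ cong (_+ 4) (*-distribʳ-+ (length Ps) 2 2) ⟨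
      4 * length Ps + 4 ≡⟨ +-comm _ 4 ⟩
      4 + 4 * length Ps ≡⟨ *-suc 4 (length Ps) ⟨
      4 * suc (length Ps) ∎

-- Agreement of orientations

T-injective : ∀ {a b} → (T a → T b) → (T b → T a) → a ≡ b
T-injective {false} {false} f g = refl
T-injective {false} {true} f g = ⊥-elim (g _)
T-injective {true} {false} f g = ⊥-elim (f _)
T-injective {true} {true} f g = refl

≗⇒⊆ : ∀ {n} {P Q : SepSet n} → P ≗ Q → ⟦ P ⟧ ⊆ ⟦ Q ⟧
≗⇒⊆ e {s} = subst T (e s)

≐⇒≗ : ∀ {n} {P Q : SepSet n} → ⟦ P ⟧ ≐ ⟦ Q ⟧ → P ≗ Q
≐⇒≗ (f , g) s = T-injective f g

_⊆ˢ?_ : ∀ {n} (P Q : SepSet n) → Dec (⟦ P ⟧ ⊆ ⟦ Q ⟧)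
P ⊆ˢ? Q = ⊆-seps? (T? ∘ P) (T? ∘ Q)

→-dec : {A B : Set} → Dec A → Dec B → Dec (A → B)
→-dec (yes a) (yes b) = yes λ _ → b
→-dec (yes a) (no ¬b) = no λ f → ¬b (f a)
→-dec (no ¬a) _ = yes λ a → contradiction a ¬a

module _ {n : ℕ} where

  private
    variable
      r s t : Sep n
      X Y : Pred (Sep n) 0ℓ
      O O′ P Q : SepSet n

  Agree : Pred (Sep n) 0ℓ → SepSet n → SepSet n → Set
  Agree X P Q = ∀ s → s ∈ X → P s ≡ Q s

  agree? : Decidable X → ∀ P Q → Dec (Agree X P Q)
  agree? X? P Q = all-seps? λ s → →-dec (X? s) (P s Bool.≟ Q s)

  distinguishes? : Decidable X → ∀ P Q → Dec (Distinguishes X P Q)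
  distinguishes? X? P Q = any-sep? λ s → X? s ×-dec (T? (P s) ×-dec T? (Q (swap s)))

  agree⊎distinguishes : Decidable X → (∀ {s} → s ∈ X → swap s ∈ X) →
                        Orientation X P → Orientation X Q → Agree X P Q ⊎ Distinguishes X P Q
  agree⊎distinguishes {P = P} {Q = Q} X? X-swap oP oQ with distinguishes? X? P Q
  ... | yes d = inj₂ d
  ... | no ¬d = inj₁ λ s Xs → T-injective
    (λ s∈P → [ id , (λ s*∈Q → ⊥-elim (¬d (s , Xs , s∈P , s*∈Q))) ]′ (oriented oQ Xs))
    (λ s∈Q → [ id , (λ s*∈P → ⊥-elim (¬d (swap s , X-swap Xs , s*∈P , s∈Q))) ]′ (oriented oP Xs))

  orientation : O ∈ ConsistentOrientation X → Orientation X O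
  orientation ((_ , o) , c) = record
    { oriented = λ Xs → Sum.map proj₁ proj₂ (o Xs) ; consistent = c }

  ≐-or-distinguishes : Decidable X → (∀ {s} → s ∈ X → swap s ∈ X) →
                       O ∈ ConsistentOrientation X → O′ ∈ ConsistentOrientation X →
                       ⟦ O ⟧ ≐ ⟦ O′ ⟧ ⊎ Distinguishes X O O′
  ≐-or-distinguishes X? X-swap c c′ =
    Sum.map₁ (λ a → (λ {s} s∈ → subst T (a s (proj₁ (proj₁ c) s∈)) s∈) ,
                    (λ {s} s∈ → subst T (sym (a s (proj₁ (proj₁ c′) s∈))) s∈))
             (agree⊎distinguishes X? X-swap (orientation c) (orientation c′))

  module _ (X? : Decidable X) where

    restrict : SepSet n → SepSet n
    restrict P s = ⌊ X? s ⌋ ∧ P s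

    restrict⁻ : s ∈ ⟦ restrict P ⟧ → s ∈ X × s ∈ ⟦ P ⟧
    restrict⁻ {s} m with X? s
    ... | yes Xs = Xs , m

    restrict⁺ : s ∈ X → s ∈ ⟦ P ⟧ → s ∈ ⟦ restrict P ⟧
    restrict⁺ {s} Xs m with X? s
    ... | yes _ = m
    ... | no ¬Xs = ¬Xs Xs

    restrict-consistentOrientation :
      (∀ {s} → s ∈ X → swap s ∈ X) → Orientation X P → restrict P ∈ ConsistentOrientation X
    restrict-consistentOrientation {P} X-swap o =
      ((λ m → proj₁ (restrict⁻ {P = P} m)) , λ Xs →
        [ (λ s∈ → inj₁ (restrict⁺ {P = P} Xs s∈ ,
                        λ s*∈ → antisymmetric o s∈ (proj₂ (restrict⁻ {P = P} s*∈))))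
        , (λ s*∈ → inj₂ ((λ s∈ → antisymmetric o (proj₂ (restrict⁻ {P = P} s∈)) s*∈) ,
                         restrict⁺ {P = P} (X-swap Xs) s*∈)) ]′
        (oriented o Xs)) ,
      λ s∈ t∈ → consistent o (proj₂ (restrict⁻ {P = P} s∈)) (proj₂ (restrict⁻ {P = P} t∈))

  -- Since P and Q both contain r but orient s oppositely, consistency leaves only the relations in
  -- which r points towards s.
  free-below : Consistent ⟦ P ⟧ → Consistent ⟦ Q ⟧ → s ∈ ⟦ P ⟧ → r ∈ ⟦ P ⟧ →
               swap s ∈ ⟦ Q ⟧ → r ∈ ⟦ Q ⟧ → Nested s r → r ≼ s ⊎ r ≼ swap s
  free-below cP cQ s∈P r∈P s*∈Q r∈Q (inj₁ (inj₁ s≼r)) = ⊥-elim (cQ s*∈Q r∈Q (≼-swap s≼r))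
  free-below cP cQ s∈P r∈P s*∈Q r∈Q (inj₁ (inj₂ r≼s)) = inj₁ r≼s
  free-below cP cQ s∈P r∈P s*∈Q r∈Q (inj₂ (inj₁ s≼r*)) = inj₂ (≼-swap s≼r*)
  free-below cP cQ s∈P r∈P s*∈Q r∈Q (inj₂ (inj₂ r*≼s)) = ⊥-elim (cP s∈P r∈P r*≼s)

  -- For separations from different branches: some r is oriented oppositely by the branches, and s
  -- and t lie on different sides of it.
  nested-across : r ≼ s ⊎ r ≼ swap s → swap r ≼ t ⊎ swap r ≼ swap t → Nested s t
  nested-across (inj₁ a) (inj₁ b) = inj₂ (inj₂ (≼-trans (≼-swap b) a))
  nested-across (inj₁ a) (inj₂ b) = inj₁ (inj₂ (≼-trans (≼-swap b) a))
  nested-across (inj₂ a) (inj₁ b) = inj₁ (inj₁ (≼-swap (≼-trans (≼-swap b) a)))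
  nested-across (inj₂ a) (inj₂ b) = inj₂ (inj₁ (≼-swap (≼-trans (≼-swap b) a)))

-- Feasible tasks

-- `proper` is stated for one side only; `S-swap` supplies the other. The list may repeat profiles
-- and represents 𝒫 up to pointwise equality. For separations of a graph, `feasible` will come from
-- the submodularity of the order.
record Task {n : ℕ} (S : Pred (Sep n) 0ℓ) (𝒫 : Pred (SepSet n) 0ℓ) : Set where
  field
    S?       : Decidable S
    proper   : ∀ {s} → s ∈ S → ¬ (s ≼ swap s)
    S-swap   : ∀ {s} → s ∈ S → swap s ∈ S
    profiles : List (SepSet n)
    sound    : ∀ {P} → P ∈ˡ profiles → P ∈ 𝒫
    complete : ∀ {P} → P ∈ 𝒫 → ∃[ Q ] Q ∈ˡ profiles × Q ≗ P
    orients  : ∀ {P} → P ∈ 𝒫 → Orientation S P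
    feasible : ∀ {s t P Q} → s ∈ S → t ∈ S → ¬ Nested s t → P ∈ 𝒫 → Q ∈ 𝒫 →
               s ∈ ⟦ P ⟧ → t ∈ ⟦ P ⟧ → swap s ∈ ⟦ Q ⟧ → swap t ∈ ⟦ Q ⟧ →
               ∃[ u ] u ∈ S × s ≼ u × t ≼ u × u ∈ ⟦ P ⟧ × swap u ∈ ⟦ Q ⟧

module _ {n : ℕ} {S : Pred (Sep n) 0ℓ} {𝒫 : Pred (SepSet n) 0ℓ} (τ : Task S 𝒫) where
  open Task τ

  private
    R = Relevant S 𝒫
    variable
      s t u : Sep n
      P Q : SepSet n

  some-profile? : {Φ : SepSet n → Set} → (∀ {P Q} → P ≗ Q → Φ P → Φ Q) → (∀ P → Dec (Φ P)) →
                  Dec (∃[ P ] P ∈ 𝒫 × Φ P)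
  some-profile? {Φ} resp Φ? = map′
    (λ a → case find a of λ { (P , m , φ) → P , sound m , φ })
    (λ { (P , P∈ , φ) → case complete P∈ of λ { (Q , m , e) → lose m (resp (sym ∘ e) φ) } })
    (Any.any? Φ? profiles)

  relevant? : Decidable R
  relevant? s = S? s ×-dec
    (some-profile? (λ e → subst T (e _)) (λ P → T? (P s)) ×-dec
     some-profile? (λ e → subst T (e _)) (λ P → T? (P (swap s))))

  relevant-swap : s ∈ R → swap s ∈ R
  relevant-swap (Ss , a , b) = S-swap Ss , b , a

  -- If a relevant t crosses s, two profiles can be found that orient both s and t oppositely. Then
  -- `feasible` yields a relevant upper bound of s and one orientation of t, and maximality
  -- identifies it with s.
  maximal⇒extremal : s ∈ Maximal R → s ∈ Extremal R
  maximal⇒extremal {s} (Rs@(Ss , (P , P∈ , s∈P) , (P′ , P′∈ , s*∈P′)) , max) = Rs , λ {t} → cmp {t}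
    where
    joined : ∀ {t P Q} → t ∈ R → ¬ Nested s t → P ∈ 𝒫 → Q ∈ 𝒫 →
             s ∈ ⟦ P ⟧ → t ∈ ⟦ P ⟧ → swap s ∈ ⟦ Q ⟧ → swap t ∈ ⟦ Q ⟧ → t ≼ s
    joined Rt ¬nest P∈ Q∈ a b c d with feasible Ss (proj₁ Rt) ¬nest P∈ Q∈ a b c d
    ... | u , Su , s≼u , t≼u , u∈P , u*∈Q with max (Su , (_ , P∈ , u∈P) , (_ , Q∈ , u*∈Q)) s≼u
    ...   | refl = t≼u
    cmp : t ∈ R → t ≼ s ⊎ swap t ≼ s
    cmp {t} Rt with nested? s t
    ... | yes (inj₁ (inj₁ s≼t)) with max Rt s≼t
    ...   | refl = inj₁ ≼-refl
    cmp {t} Rt | yes (inj₁ (inj₂ t≼s)) = inj₁ t≼s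
    cmp {t} Rt | yes (inj₂ (inj₁ s≼t*)) with max (relevant-swap Rt) s≼t*
    ...   | refl = inj₂ ≼-refl
    cmp {t} Rt | yes (inj₂ (inj₂ t*≼s)) = inj₂ t*≼s
    cmp {t} Rt@(St , (Q , Q∈ , t∈Q) , (Q′ , Q′∈ , t*∈Q′)) | no ¬nest
      with oriented (orients P∈) St | oriented (orients P′∈) St
    ... | inj₁ t∈P | inj₂ t*∈P′ = inj₁ (joined Rt ¬nest P∈ P′∈ s∈P t∈P s*∈P′ t*∈P′)
    ... | inj₂ t*∈P | inj₁ t∈P′ = inj₂ (joined (relevant-swap Rt) (¬nest ∘ nested-swapʳ) P∈ P′∈ s∈P t*∈P s*∈P′ t∈P′)
    -- P and P′ agree on t; by relevance Q′ disagrees with them there, and it replaces one of the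
    -- two according to how it orients s.
    ... | inj₁ t∈P | inj₁ t∈P′ with oriented (orients Q′∈) Ss
    ...   | inj₁ s∈Q′ = inj₂ (joined (relevant-swap Rt) (¬nest ∘ nested-swapʳ) Q′∈ P′∈ s∈Q′ t*∈Q′ s*∈P′ t∈P′)
    ...   | inj₂ s*∈Q′ = inj₁ (joined Rt ¬nest P∈ Q′∈ s∈P t∈P s*∈Q′ t*∈Q′)
    cmp {t} Rt@(St , (Q , Q∈ , t∈Q) , (Q′ , Q′∈ , t*∈Q′)) | no ¬nest | inj₂ t*∈P | inj₂ t*∈P′
      with oriented (orients Q∈) Ss
    ...   | inj₁ s∈Q = inj₁ (joined Rt ¬nest Q∈ P′∈ s∈Q t∈Q s*∈P′ t*∈P′)
    ...   | inj₂ s*∈Q = inj₂ (joined (relevant-swap Rt) (¬nest ∘ nested-swapʳ) P∈ Q∈ s∈P t*∈P s*∈Q t∈Q)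

  extremal-exists : Satisfiable R → Satisfiable (Extremal R)
  extremal-exists (s , Rs) with maximal-above relevant? Rs
  ... | t , _ , max = t , maximal⇒extremal max

  extremal⇒greatest : s ∈ Extremal R → P ∈ 𝒫 → s ∈ ⟦ P ⟧ → t ∈ ⟦ P ⟧ → t ∈ R → t ≼ s
  extremal⇒greatest (_ , ext) P∈ s∈P t∈P Rt with ext Rt
  ... | inj₁ t≼s = t≼s
  ... | inj₂ t*≼s = ⊥-elim (consistent (orients P∈) s∈P t∈P t*≼s)

  -- In a profile containing it, an extremal separation is the greatest relevant element, so it is
  -- the only maximal one and there is nothing to be nested with.
  extremal⇒locallyMaximal : s ∈ Extremal R → s ∈ LocallyMaximal R 𝒫
  extremal⇒locallyMaximal {s} e@(Rs@(_ , (P , P∈ , s∈P) , _) , ext) =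
    P , P∈ , wellSeparated , (s∈P , Rs) , λ { (t∈P , Rt) s≼t → ≼-antisym (extremal⇒greatest e P∈ s∈P t∈P Rt) s≼t }
    where
    maximal≡ : t ∈ Maximal (⟦ P ⟧ ∩ᵖ R) → s ≡ t
    maximal≡ ((t∈P , Rt) , max) = max (s∈P , Rs) (extremal⇒greatest e P∈ s∈P t∈P Rt)
    wellSeparated : WellSeparated R P
    wellSeparated u∈ v∈ with maximal≡ u∈ | maximal≡ v∈
    ... | refl | refl = inj₁ (inj₁ ≼-refl)

  locallyMaximal⇒relevant : s ∈ LocallyMaximal R 𝒫 → s ∈ R
  locallyMaximal⇒relevant (_ , _ , _ , (_ , Rs) , _) = Rs

  -- Up to inversion t lies in P, hence below a maximal t′, which is nested with s as P is well
  -- separated. Maximality of s and consistency of P leave only relations that pass from t′ down to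
  -- t.
  locallyMaximal⇒nested : s ∈ LocallyMaximal R 𝒫 → t ∈ R → Nested s t
  locallyMaximal⇒nested {s} {t} (P , P∈ , ws , max@((s∈P , Rs) , smax)) Rt =
    [ (λ t∈P → nested-in t∈P Rt) , (λ t*∈P → nested-swapʳ (nested-in t*∈P (relevant-swap Rt))) ]′
      (oriented (orients P∈) (proj₁ Rt))
    where
    nested-in : ∀ {t} → t ∈ ⟦ P ⟧ → t ∈ R → Nested s t
    nested-in t∈P Rt with maximal-above (λ u → T? (P u) ×-dec relevant? u) (t∈P , Rt)
    ... | t′ , t≼t′ , max′@((t′∈P , Rt′) , _) with ws max max′
    ...   | inj₁ (inj₁ s≼t′) with smax (t′∈P , Rt′) s≼t′
    ...     | refl = inj₁ (inj₂ t≼t′)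
    nested-in t∈P Rt | t′ , t≼t′ , _ | inj₁ (inj₂ t′≼s) = inj₁ (inj₂ (≼-trans t≼t′ t′≼s))
    nested-in t∈P Rt | t′ , t≼t′ , _ | inj₂ (inj₁ s≼t′*) = inj₂ (inj₁ (≼-trans s≼t′* (≼-swap t≼t′)))
    nested-in t∈P Rt | t′ , t≼t′ , ((t′∈P , _) , _) | inj₂ (inj₂ t′*≼s) =
      ⊥-elim (consistent (orients P∈) s∈P t′∈P t′*≼s)

-- Strategies

-- What the arguments need of σ; both extᵣ and locᵣ qualify.
record Selects {n : ℕ} (σ : Selector n) : Set₁ where
  field
    resp  : ∀ {S S′ 𝒫 𝒫′} → S ≐ S′ → 𝒫 ≐ 𝒫′ → σ S 𝒫 ⊆ σ S′ 𝒫′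
    swap⁺ : ∀ {S 𝒫 s} → s ∈ σ S 𝒫 → swap s ∈ σ S 𝒫
    dec   : ∀ {S 𝒫} → Task S 𝒫 → Decidable (σ S 𝒫)
    ext⊆  : ∀ {S 𝒫} → Task S 𝒫 → extᵣ S 𝒫 ⊆ σ S 𝒫
    ⊆loc  : ∀ {S 𝒫} → Task S 𝒫 → σ S 𝒫 ⊆ locᵣ S 𝒫

relevant-resp : ∀ {n} {S S′ : Pred (Sep n) 0ℓ} {𝒫 𝒫′} → S ⊆ S′ → 𝒫 ⊆ 𝒫′ → Relevant S 𝒫 ⊆ Relevant S′ 𝒫′
relevant-resp f g (Ss , (P , P∈ , a) , (Q , Q∈ , b)) = f Ss , (P , g P∈ , a) , (Q , g Q∈ , b)

restrictS-⊆ : ∀ {n} {S S′ N N′ : Pred (Sep n) 0ℓ} {O O′} → S ⊆ S′ → N′ ⊆ N → ⟦ O′ ⟧ ⊆ ⟦ O ⟧ →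
              restrictS S N O ⊆ restrictS S′ N′ O′
restrictS-⊆ f g h (Ss , nest , c , c*) =
  f Ss , (λ m → nest (g m)) ,
  (λ u v → c (Sum.map₁ h u) (Sum.map₁ h v)) , (λ u v → c* (Sum.map₁ h u) (Sum.map₁ h v))

extending-⊆ : ∀ {n} {𝒫 𝒫′ : Pred (SepSet n) 0ℓ} {O O′} → 𝒫 ⊆ 𝒫′ → ⟦ O′ ⟧ ⊆ ⟦ O ⟧ →
              extending 𝒫 O ⊆ extending 𝒫′ O′
extending-⊆ f h (P∈ , O⊆P) = f P∈ , λ m → O⊆P (h m)

module Strategy {n : ℕ} {σ : Selector n} (sel : Selects σ) where
  open Selects sel

  private
    variable
      s t : Sep n
      S S′ : Pred (Sep n) 0ℓ
      𝒫 𝒫′ : Pred (SepSet n) 0ℓ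
      O P Q : SepSet n

  selected⇒relevant : Task S 𝒫 → σ S 𝒫 ⊆ Relevant S 𝒫
  selected⇒relevant τ Ns with ⊆loc τ Ns
  ... | inj₁ l = locallyMaximal⇒relevant τ l
  ... | inj₂ l = relevant-swap τ (locallyMaximal⇒relevant τ l)

  selected⇒nested : Task S 𝒫 → s ∈ σ S 𝒫 → t ∈ Relevant S 𝒫 → Nested s t
  selected⇒nested τ Ns Rt with ⊆loc τ Ns
  ... | inj₁ l = locallyMaximal⇒nested τ l Rt
  ... | inj₂ l = nested-swapˡ (locallyMaximal⇒nested τ l Rt)

  orientsN : Task S 𝒫 → P ∈ 𝒫 → Orientation (σ S 𝒫) P
  orientsN τ P∈ = record
    { oriented = λ Ns → oriented (Task.orients τ P∈) (proj₁ (selected⇒relevant τ Ns))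
    ; consistent = consistent (Task.orients τ P∈) }

  -- O together with s lies in P, and O together with `swap s` lies in Q; nestedness with the
  -- selected set comes from the relevance of s. So whatever distinguishes two profiles of a branch
  -- remains available in it.
  relevant-restricts : Task S 𝒫 → P ∈ 𝒫 → Q ∈ 𝒫 → ⟦ O ⟧ ⊆ ⟦ P ⟧ → ⟦ O ⟧ ⊆ ⟦ Q ⟧ →
                       s ∈ S → s ∈ ⟦ P ⟧ → swap s ∈ ⟦ Q ⟧ → s ∈ restrictS S (σ S 𝒫) O
  relevant-restricts {P = P} {Q = Q} {O = O} {s = s} τ P∈ Q∈ O⊆P O⊆Q Ss s∈P s*∈Q =
    Ss , (λ Nt → nested-sym (selected⇒nested τ Nt (Ss , (_ , P∈ , s∈P) , (_ , Q∈ , s*∈Q)))) ,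
    (λ u∈ v∈ → consistent (Task.orients τ P∈) (inP u∈) (inP v∈)) ,
    (λ u∈ v∈ → consistent (Task.orients τ Q∈) (inQ u∈) (inQ v∈))
    where
    inP : (⟦ O ⟧ ∪ᵖ ｛ s ｝) ⊆ ⟦ P ⟧
    inP = [ O⊆P , (λ { refl → s∈P }) ]′
    inQ : (⟦ O ⟧ ∪ᵖ ｛ swap s ｝) ⊆ ⟦ Q ⟧
    inQ = [ O⊆Q , (λ { refl → s*∈Q }) ]′

  restrictS? : Task S 𝒫 → ∀ O → Decidable (restrictS S (σ S 𝒫) O)
  restrictS? {S} {𝒫} τ O s =
    Task.S? τ s ×-dec
    (⊆-seps? (dec τ) (λ t → nested? s t) ×-dec
    (consistent? s ×-dec consistent? (swap s)))
    where
    consistent? : ∀ s → Dec (Consistent (⟦ O ⟧ ∪ᵖ ｛ s ｝))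
    consistent? s = map′ (λ f {u} {v} u∈ v∈ → f u v u∈ v∈) (λ f u v → f)
      (all-seps? λ u → all-seps? λ v → →-dec (m? u) (→-dec (m? v) (¬? (swap v ≼? u))))
      where
      m? : Decidable (⟦ O ⟧ ∪ᵖ ｛ s ｝)
      m? t = T? (O t) ⊎-dec (s ≟ˢ t)

  subtask : Task S 𝒫 → ∀ O → Task (restrictS S (σ S 𝒫) O) (extending 𝒫 O)
  subtask {S} {𝒫} τ O = record
    { S? = restrictS? τ O
    ; proper = proper ∘ proj₁
    ; S-swap = λ { (Ss , nest , c , c*) → S-swap Ss , (λ Nt → nested-swapˡ (nest Nt)) , c* , c }
    ; profiles = filter (O ⊆ˢ?_) profiles
    ; sound = sound′
    ; complete = complete′
    ; orients = λ { (P∈ , _) → record { oriented = oriented (orients P∈) ∘ proj₁ ; consistent = consistent (orients P∈) } }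
    -- The upper bound distinguishes P from Q and therefore survives into the branch.
    ; feasible = λ { (Ss , _) (St , _) ¬nest (P∈ , O⊆P) (Q∈ , O⊆Q) a b c d →
        case feasible Ss St ¬nest P∈ Q∈ a b c d of λ
          { (u , Su , s≼u , t≼u , u∈P , u*∈Q) →
            u , relevant-restricts τ P∈ Q∈ O⊆P O⊆Q Su u∈P u*∈Q , s≼u , t≼u , u∈P , u*∈Q } }
    }
    where
    open Task τ
    sound′ : ∀ {P} → P ∈ˡ filter (O ⊆ˢ?_) profiles → P ∈ extending 𝒫 O
    sound′ m with ∈-filter⁻ (O ⊆ˢ?_) {xs = profiles} m
    ... | m′ , O⊆P = sound m′ , O⊆P
    complete′ : ∀ {P} → P ∈ extending 𝒫 O → ∃[ Q ] Q ∈ˡ filter (O ⊆ˢ?_) profiles × Q ≗ P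
    complete′ (P∈ , O⊆P) with complete P∈
    ... | Q , m , e = Q , ∈-filter⁺ (O ⊆ˢ?_) m (λ x∈ → ≗⇒⊆ (sym ∘ e) (O⊆P x∈)) , e

  subtask-relevant⊆ : Relevant (restrictS S (σ S 𝒫) O) (extending 𝒫 O) ⊆ Relevant S 𝒫
  subtask-relevant⊆ {S} {𝒫} {O} = relevant-resp {S = restrictS S (σ S 𝒫) O} {S} {extending 𝒫 O} {𝒫} proj₁ proj₁

  -- Orientations with the same elements lead to tasks that are only equivalent, not equal; this
  -- moves membership between their branches.
  strategySet-resp : S ≐ S′ → 𝒫 ≐ 𝒫′ → StrategySet σ S 𝒫 ⊆ StrategySet σ S′ 𝒫′
  strategySet-resp {S} {S′} {𝒫} {𝒫′} S≐ 𝒫≐ (select (r , Rr) Ns) =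
    select (r , relevant-resp {S = S} {S′} {𝒫} {𝒫′} (proj₁ S≐) (proj₁ 𝒫≐) Rr) (resp {S} {S′} {𝒫} {𝒫′} S≐ 𝒫≐ Ns)
  strategySet-resp {S} {S′} {𝒫} {𝒫′} S≐ 𝒫≐ (recurse (r , Rr) O ((O⊆N , o) , c) d) =
    recurse (r , relevant-resp {S = S} {S′} {𝒫} {𝒫′} (proj₁ S≐) (proj₁ 𝒫≐) Rr) O
      ((N⊆ ∘ O⊆N , o ∘ N⊇) , c)
      (strategySet-resp
        (restrictS-⊆ {S = S} {S′} {O = O} {O} (proj₁ S≐) N⊇ id , restrictS-⊆ {S = S′} {S} {O = O} {O} (proj₂ S≐) N⊆ id)
        (extending-⊆ {𝒫 = 𝒫} {𝒫′} {O} {O} (proj₁ 𝒫≐) id , extending-⊆ {𝒫 = 𝒫′} {𝒫} {O} {O} (proj₂ 𝒫≐) id) d)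
    where
    N⊆ : σ S 𝒫 ⊆ σ S′ 𝒫′
    N⊆ = resp {S} {S′} {𝒫} {𝒫′} S≐ 𝒫≐
    N⊇ : σ S′ 𝒫′ ⊆ σ S 𝒫
    N⊇ = resp {S′} {S} {𝒫′} {𝒫} (swap S≐) (swap 𝒫≐)

  subtask-resp : {O O′ : SepSet n} → ⟦ O ⟧ ≐ ⟦ O′ ⟧ →
    StrategySet σ (restrictS S (σ S 𝒫) O) (extending 𝒫 O) ⊆
    StrategySet σ (restrictS S (σ S 𝒫) O′) (extending 𝒫 O′)
  subtask-resp {S} {𝒫} {O = O} {O′} (f , g) = strategySet-resp
    (restrictS-⊆ {S = S} {S} {σ S 𝒫} {σ S 𝒫} {O} {O′} id id g , restrictS-⊆ {S = S} {S} {σ S 𝒫} {σ S 𝒫} {O′} {O} id id f)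
    (extending-⊆ {𝒫 = 𝒫} {𝒫} {O} {O′} id g , extending-⊆ {𝒫 = 𝒫} {𝒫} {O′} {O} id f)

  strategySet⊆relevant : Task S 𝒫 → StrategySet σ S 𝒫 ⊆ Relevant S 𝒫
  strategySet⊆relevant τ (select _ Ns) = selected⇒relevant τ Ns
  strategySet⊆relevant τ (recurse _ O _ d) = subtask-relevant⊆ {_} {_} {O} (strategySet⊆relevant (subtask τ O) d)

  strategySet-swap : s ∈ StrategySet σ S 𝒫 → swap s ∈ StrategySet σ S 𝒫
  strategySet-swap (select sat Ns) = select sat (swap⁺ Ns)
  strategySet-swap (recurse sat O co d) = recurse sat O co (strategySet-swap d)

  strategySet-nested : Task S 𝒫 → s ∈ StrategySet σ S 𝒫 → t ∈ StrategySet σ S 𝒫 → Nested s t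
  strategySet-nested τ (select _ Ns) d = selected⇒nested τ Ns (strategySet⊆relevant τ d)
  strategySet-nested τ d@(recurse _ _ _ _) (select _ Nt) =
    nested-sym (selected⇒nested τ Nt (strategySet⊆relevant τ d))
  strategySet-nested {S} {𝒫} τ (recurse _ O co d) (recurse _ O′ co′ d′)
    with ≐-or-distinguishes (dec τ) swap⁺ co co′
  ... | inj₁ O≐O′ = strategySet-nested (subtask τ O) d (subtask-resp (swap O≐O′) d′)
  ... | inj₂ (r , Nr , r∈O , r*∈O′)
    with strategySet⊆relevant (subtask τ O) d | strategySet⊆relevant (subtask τ O′) d′
  ...   | (_ , nest , _) , (P , (P∈ , O⊆P) , s∈P) , (Q , (Q∈ , O⊆Q) , s*∈Q)
        | (_ , nest′ , _) , (P′ , (P′∈ , O′⊆P′) , t∈P′) , (Q′ , (Q′∈ , O′⊆Q′) , t*∈Q′) =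
    nested-across
      (free-below {P = P} {Q} (con P∈) (con Q∈) s∈P (O⊆P r∈O) s*∈Q (O⊆Q r∈O) (nest Nr))
      (free-below {P = P′} {Q′} (con P′∈) (con Q′∈) t∈P′ (O′⊆P′ r*∈O′) t*∈Q′ (O′⊆Q′ r*∈O′) (nest′ (swap⁺ Nr)))
    where
    con : ∀ {P} → P ∈ 𝒫 → Consistent ⟦ P ⟧
    con m = consistent (Task.orients τ m)

  -- The measure of the recursion decreases: whichever way O orients the selected separation,
  -- relevance supplies a profile that orients it the other way and drops out.
  subtask-shrinks : (τ : Task S 𝒫) → s ∈ σ S 𝒫 → O ∈ ConsistentOrientation (σ S 𝒫) →
                    length (Task.profiles (subtask τ O)) < length (Task.profiles τ)
  subtask-shrinks {S} {𝒫} {O = O} τ Ns co =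
    filter-notAll (O ⊆ˢ?_) profiles
      ([ (λ s∈O → avoid s∈O (proj₂ (proj₂ (selected⇒relevant τ Ns))))
       , (λ s*∈O → avoid s*∈O (proj₁ (proj₂ (selected⇒relevant τ Ns)))) ]′ (oriented (orientation co) Ns))
    where
    open Task τ
    avoid : ∀ {r} → r ∈ ⟦ O ⟧ → ∃[ P ] P ∈ 𝒫 × swap r ∈ ⟦ P ⟧ → Any.Any (λ P → ¬ (⟦ O ⟧ ⊆ ⟦ P ⟧)) profiles
    avoid r∈O (P , P∈ , r*∈P) with complete P∈
    ... | Q , m , e = lose m λ O⊆Q → antisymmetric (orients (sound m)) (O⊆Q r∈O) (≗⇒⊆ (sym ∘ e) r*∈P)

  selected-exists : Task S 𝒫 → Satisfiable (Relevant S 𝒫) → Satisfiable (σ S 𝒫)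
  selected-exists τ sat with extremal-exists τ sat
  ... | e , ext = e , ext⊆ τ (inj₁ ext)

  -- If the selected set does not distinguish P from Q, both extend the same orientation `O₁` of it,
  -- and s survives into that branch.
  strategySet-distinguishes : (τ : Task S 𝒫) → P ∈ 𝒫 → Q ∈ 𝒫 → Distinguishes S P Q →
                              Distinguishes (StrategySet σ S 𝒫) P Q
  strategySet-distinguishes τ = go τ _ ≤-refl
    where
    go : ∀ {S 𝒫 P Q} (τ : Task S 𝒫) m → length (Task.profiles τ) < m → P ∈ 𝒫 → Q ∈ 𝒫 →
         Distinguishes S P Q → Distinguishes (StrategySet σ S 𝒫) P Q
    go {S} {𝒫} {P} {Q} τ (suc m) (s≤s le) P∈ Q∈ (s , Ss , s∈P , s*∈Q) =
      split (agree⊎distinguishes (dec τ) swap⁺ (orientsN τ P∈) (orientsN τ Q∈))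
      where
      sat : Satisfiable (Relevant S 𝒫)
      sat = s , Ss , (P , P∈ , s∈P) , (Q , Q∈ , s*∈Q)
      split : Agree (σ S 𝒫) P Q ⊎ Distinguishes (σ S 𝒫) P Q → Distinguishes (StrategySet σ S 𝒫) P Q
      split (inj₂ (r , Nr , r∈P , r*∈Q)) = r , select sat Nr , r∈P , r*∈Q
      split (inj₁ agree) =
        case go (subtask τ O₁) m (≤-trans (subtask-shrinks τ (proj₂ (selected-exists τ sat)) co) le)
                (P∈ , O₁⊆P) (Q∈ , O₁⊆Q) (s , relevant-restricts τ P∈ Q∈ O₁⊆P O₁⊆Q Ss s∈P s*∈Q , s∈P , s*∈Q) of λ
          { (r , d , a , b) → r , recurse sat O₁ co d , a , b }
        where
        O₁ : SepSet n
        O₁ = restrict (dec τ) P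
        co : O₁ ∈ ConsistentOrientation (σ S 𝒫)
        co = restrict-consistentOrientation (dec τ) swap⁺ (orientsN τ P∈)
        O₁⊆P : ⟦ O₁ ⟧ ⊆ ⟦ P ⟧
        O₁⊆P m = proj₂ (restrict⁻ (dec τ) {P = P} m)
        O₁⊆Q : ⟦ O₁ ⟧ ⊆ ⟦ Q ⟧
        O₁⊆Q {s} m with restrict⁻ (dec τ) {P = P} m
        ... | Ns , s∈P = subst T (agree s Ns) s∈P

  subset-unique : ∀ {O O′} → Task S 𝒫 → P ∈ 𝒫 → O ∈ ConsistentOrientation (σ S 𝒫) →
                  O′ ∈ ConsistentOrientation (σ S 𝒫) → ⟦ O ⟧ ⊆ ⟦ P ⟧ → ⟦ O′ ⟧ ⊆ ⟦ P ⟧ → ⟦ O ⟧ ≐ ⟦ O′ ⟧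
  subset-unique τ P∈ co co′ O⊆P O′⊆P with ≐-or-distinguishes (dec τ) swap⁺ co co′
  ... | inj₁ e = e
  ... | inj₂ (r , _ , r∈O , r*∈O′) = ⊥-elim (antisymmetric (Task.orients τ P∈) (O⊆P r∈O) (O′⊆P r*∈O′))

  -- The bound 4(m - 1) without truncated subtraction. The list may repeat entries, since its length
  -- only serves as an upper bound.
  Enumeration : Pred (Sep n) 0ℓ → Pred (SepSet n) 0ℓ → ℕ → Set
  Enumeration S 𝒫 m = ∃[ xs ] (_∈ˡ xs) ≐ StrategySet σ S 𝒫 × length xs + 4 ≤ 4 * m

  strategySet-enumeration : (τ : Task S 𝒫) → P ∈ˡ Task.profiles τ → Enumeration S 𝒫 (length (Task.profiles τ))
  strategySet-enumeration τ = go τ _ ≤-refl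
    where
    go : ∀ {S 𝒫 P} (τ : Task S 𝒫) m → length (Task.profiles τ) < m →
         P ∈ˡ Task.profiles τ → Enumeration S 𝒫 (length (Task.profiles τ))
    go {S} {𝒫} {P} τ (suc m) (s≤s le) P∈ˡ with any-sep? (relevant? τ)
    ... | no ¬sat = [] , ((λ ()) , λ { (select sat _) → ⊥-elim (¬sat sat) ; (recurse sat _ _ _) → ⊥-elim (¬sat sat) }) ,
                    4≤4*length P∈ˡ
      where
      4≤4*length : ∀ {xs : List (SepSet n)} → P ∈ˡ xs → 4 ≤ 4 * length xs
      4≤4*length {_ ∷ xs} _ = *-monoʳ-≤ 4 (s≤s (z≤n {length xs}))
    ... | yes sat = combine Qs refl
      where
      open Task τ
      N : Pred (Sep n) 0ℓ
      N = σ S 𝒫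
      N? : Decidable N
      N? = dec τ

      same? : ∀ P Q → Dec (Agree N P Q)
      same? = agree? N?

      Qs : List (SepSet n)
      Qs = deduplicate same? profiles

      Qs-sound : ∀ {Q} → Q ∈ˡ Qs → Q ∈ˡ profiles
      Qs-sound = ∈-deduplicate⁻ same? profiles

      Qs-complete : ∀ {P} → P ∈ 𝒫 → ∃[ Q ] Q ∈ˡ Qs × Agree N Q P
      Qs-complete P∈ with complete P∈
      ... | P′ , m′ , e with deduplicate-represents same? (λ _ _ → refl) (λ f g s Ns → trans (f s Ns) (g s Ns)) m′
      ... | Q , mQ , a = Q , mQ , λ s Ns → trans (a s Ns) (e s)

      Qs-distinct : AllPairs (λ P Q → ¬ Agree N P Q) Qs
      Qs-distinct = deduplicate-distinct same? profiles

      O[_] : SepSet n → SepSet n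
      O[ Q ] = restrict N? Q

      O[]⊆ : ∀ {Q} → ⟦ O[ Q ] ⟧ ⊆ ⟦ Q ⟧
      O[]⊆ {Q} m = proj₂ (restrict⁻ N? {P = Q} m)

      O[]-co : ∀ {Q} → Q ∈ 𝒫 → O[ Q ] ∈ ConsistentOrientation N
      O[]-co Q∈ = restrict-consistentOrientation N? swap⁺ (orientsN τ Q∈)

      Branch : SepSet n → Pred (Sep n) 0ℓ
      Branch Q = StrategySet σ (restrictS S N O[ Q ]) (extending 𝒫 O[ Q ])

      Selected Branches : Set
      Selected = ∃[ ys ] (_∈ˡ ys) ≐ N × length ys + 4 ≤ 4 * length Qs
      Branches = ∃[ zs ] (_∈ˡ zs) ≐ (λ s → ∃[ Q ] Q ∈ˡ Qs × s ∈ Branch Q) ×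
        length zs + 4 * length Qs ≤ 4 * sum (map (λ Q → length (filter (O[ Q ] ⊆ˢ?_) profiles)) Qs)

      branches : Branches
      branches = collect _ 4 4 Qs λ {Q} mQ →
        go (subtask τ O[ Q ]) m
           (≤-trans (subtask-shrinks τ (proj₂ (selected-exists τ sat)) (O[]-co (sound (Qs-sound mQ)))) le)
           (∈-filter⁺ (O[ Q ] ⊆ˢ?_) (Qs-sound mQ) (O[]⊆ {Q}))

      disjoint : ∀ {qs} → (∀ {Q} → Q ∈ˡ qs → Q ∈ 𝒫) → AllPairs (λ P Q → ¬ Agree N P Q) qs →
                 AllPairs (DisjointOn (λ Q P → ⟦ O[ Q ] ⟧ ⊆ ⟦ P ⟧) profiles) qs
      disjoint h [] = []
      disjoint {Q ∷ qs} h (ne ∷ ap) =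
        All.tabulate (λ {Q′} m′ {P} mP f f′ →
          [ All.lookup ne m′ ,
            (λ { (r , Nr , r∈Q , r*∈Q′) →
              antisymmetric (orients (sound mP))
                (f (restrict⁺ N? {P = Q} Nr r∈Q)) (f′ (restrict⁺ N? {P = Q′} (swap⁺ Nr) r*∈Q′)) }) ]′
          (agree⊎distinguishes N? swap⁺ (orientsN τ (h (here refl))) (orientsN τ (h (there m′)))))
        ∷ disjoint (h ∘ there) ap

      selected : ∀ {Q₀ qs} → Qs ≡ Q₀ ∷ qs → Selected
      selected {Q₀} {qs} eq = subst (λ l → ∃[ ys ] (_∈ˡ ys) ≐ N × length ys + 4 ≤ 4 * length l) (sym eq)
        (length≤4*length (λ Ns → proper (proj₁ (selected⇒relevant τ Ns))) contained locmax)
        where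
        in-𝒫 : ∀ {Q} → Q ∈ˡ Q₀ ∷ qs → Q ∈ 𝒫
        in-𝒫 {Q} m = sound (Qs-sound (subst (Q ∈ˡ_) (sym eq) m))
        -- The representative of the first class becomes the root of the tree.
        open NestedSystem N? (λ Ns Nt → selected⇒nested τ Ns (selected⇒relevant τ Nt)) swap⁺
          (orientsN τ (in-𝒫 (here refl))) qs (orientsN τ ∘ in-𝒫 ∘ there)
        contained : ∀ {s} → s ∈ N → ∃[ Q ] Q ∈ˡ Q₀ ∷ qs × s ∈ ⟦ Q ⟧
        contained {s} Ns with proj₁ (proj₂ (selected⇒relevant τ Ns))
        ... | P , P∈ , s∈P with Qs-complete P∈
        ... | Q , mQ , a = Q , subst (Q ∈ˡ_) eq mQ , subst T (sym (a s Ns)) s∈P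
        maximal-in : ∀ {s} → s ∈ N → s ∈ LocallyMaximal (Relevant S 𝒫) 𝒫 →
                     ∃[ Q ] Q ∈ˡ Q₀ ∷ qs × s ∈ Maximal (⟦ Q ⟧ ∩ᵖ N)
        maximal-in {s} Ns (P , P∈ , _ , (s∈P , _) , max) with Qs-complete P∈
        ... | Q , mQ , a = Q , subst (Q ∈ˡ_) eq mQ , (subst T (sym (a s Ns)) s∈P , Ns) ,
          λ { {t} (t∈Q , Nt) s≼t → max (subst T (a t Nt) t∈Q , selected⇒relevant τ Nt) s≼t }
        locmax : ∀ {s} → s ∈ N → ∃[ Q ] Q ∈ˡ Q₀ ∷ qs ×
                   (s ∈ Maximal (⟦ Q ⟧ ∩ᵖ N) ⊎ swap s ∈ Maximal (⟦ Q ⟧ ∩ᵖ N))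
        locmax Ns with ⊆loc τ Ns
        ... | inj₁ l = case maximal-in Ns l of λ { (Q , mQ , max) → Q , mQ , inj₁ max }
        ... | inj₂ l = case maximal-in (swap⁺ Ns) l of λ { (Q , mQ , max) → Q , mQ , inj₂ max }

      assemble : Selected → Branches → Enumeration S 𝒫 (length profiles)
      assemble (ys , (ys⊆ , ⊆ys) , ys-bound) (zs , (zs⊆ , ⊆zs) , zs-bound) =
        ys ++ zs , (snd , cmp) , bound
        where
        snd : ∀ {s} → s ∈ˡ ys ++ zs → StrategySet σ S 𝒫 s
        snd m with ∈-++⁻ ys m
        ... | inj₁ m′ = select sat (ys⊆ m′)
        ... | inj₂ m′ with zs⊆ m′
        ...   | Q , mQ , d = recurse sat O[ Q ] (O[]-co (sound (Qs-sound mQ))) d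
        cmp : ∀ {s} → StrategySet σ S 𝒫 s → s ∈ˡ ys ++ zs
        cmp (select _ Ns) = ∈-++⁺ˡ (⊆ys Ns)
        -- An orientation extended by no profile has an empty branch, so the branches of the
        -- representatives account for everything.
        cmp (recurse _ O co d) with strategySet⊆relevant (subtask τ O) d
        ... | _ , (P , (P∈ , O⊆P) , _) , _ with Qs-complete P∈
        ... | Q , mQ , a = ∈-++⁺ʳ ys (⊆zs (Q , mQ ,
          subtask-resp (subset-unique τ P∈ co (O[]-co (sound (Qs-sound mQ))) O⊆P O[Q]⊆P) d))
          where
          O[Q]⊆P : ⟦ O[ Q ] ⟧ ⊆ ⟦ P ⟧
          O[Q]⊆P {s} m = case restrict⁻ N? {P = Q} m of λ { (Ns , s∈Q) → subst T (a s Ns) s∈Q }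
        bound : length (ys ++ zs) + 4 ≤ 4 * length profiles
        bound = ≤-trans (length-++-bound ys zs ys-bound zs-bound)
          (*-monoʳ-≤ 4 (sum-length-filter≤ (λ Q P → O[ Q ] ⊆ˢ? P) Qs profiles (disjoint (sound ∘ Qs-sound) Qs-distinct)))

      combine : ∀ qs → Qs ≡ qs → Enumeration S 𝒫 (length profiles)
      combine [] eq with Qs-complete (sound P∈ˡ)
      ... | Q , mQ , _ with subst (Q ∈ˡ_) eq mQ
      ...   | ()
      combine (Q₀ ∷ qs) eq = assemble (selected eq) branches

-- The strategies Ext and Loc

module _ {n : ℕ} where

  private
    variable
      X Y : Pred (Sep n) 0ℓ
      S S′ : Pred (Sep n) 0ℓ
      𝒫 𝒫′ : Pred (SepSet n) 0ℓ
      P Q : SepSet n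

  relevant-≐ : S ≐ S′ → 𝒫 ≐ 𝒫′ → Relevant S 𝒫 ≐ Relevant S′ 𝒫′
  relevant-≐ {S} {S′} {𝒫} {𝒫′} (f , f′) (g , g′) =
    relevant-resp {S = S} {S′} {𝒫} {𝒫′} f g , relevant-resp {S = S′} {S} {𝒫′} {𝒫} f′ g′

  extremal-resp : X ≐ Y → Extremal X ⊆ Extremal Y
  extremal-resp (f , g) (Xs , ext) = f Xs , λ Yt → ext (g Yt)

  maximal-resp : X ≐ Y → Maximal X ⊆ Maximal Y
  maximal-resp (f , g) (Xs , max) = f Xs , λ Yt → max (g Yt)

  MaximalIn : Pred (Sep n) 0ℓ → Sep n → SepSet n → Set
  MaximalIn X s P = WellSeparated X P × s ∈ Maximal (⟦ P ⟧ ∩ᵖ X)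

  maximalIn-resp : X ≐ Y → ⟦ P ⟧ ≐ ⟦ Q ⟧ → ∀ {s} → MaximalIn X s P → MaximalIn Y s Q
  maximalIn-resp {X} {Y} {P} {Q} (f , f′) (g , g′) (ws , max) =
    (λ s∈ t∈ → ws (maximal-resp (swap ≐′) s∈) (maximal-resp (swap ≐′) t∈)) , maximal-resp ≐′ max
    where
    ≐′ : (⟦ P ⟧ ∩ᵖ X) ≐ (⟦ Q ⟧ ∩ᵖ Y)
    ≐′ = (λ (a , b) → g a , f b) , (λ (a , b) → g′ a , f′ b)

  extremal? : Decidable X → Decidable (Extremal X)
  extremal? X? s = X? s ×-dec ⊆-seps? X? (λ t → (t ≼? s) ⊎-dec (swap t ≼? s))

  maximalIn? : Decidable X → ∀ s P → Dec (MaximalIn X s P)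
  maximalIn? {X} X? s P =
    map′ (λ f {u} {v} u∈ v∈ → f u v u∈ v∈) (λ f u v → f)
      (all-seps? λ u → all-seps? λ v → →-dec (max? u) (→-dec (max? v) (nested? u v)))
    ×-dec max? s
    where
    max? : Decidable (Maximal (⟦ P ⟧ ∩ᵖ X))
    max? = maximal? (λ t → T? (P t) ×-dec X? t)

  extᵣ-selects : Selects {n} extᵣ
  extᵣ-selects = record
    { resp = λ {S} {S′} {𝒫} {𝒫′} S≐ 𝒫≐ →
        Sum.map (extremal-resp (relevant-≐ {S} {S′} {𝒫} {𝒫′} S≐ 𝒫≐)) (extremal-resp (relevant-≐ {S} {S′} {𝒫} {𝒫′} S≐ 𝒫≐))
    ; swap⁺ = Sum.swap
    ; dec = λ τ s → extremal? (relevant? τ) s ⊎-dec extremal? (relevant? τ) (swap s)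
    ; ext⊆ = λ _ → id
    ; ⊆loc = λ τ → Sum.map (extremal⇒locallyMaximal τ) (extremal⇒locallyMaximal τ)
    }

  locᵣ-selects : Selects {n} locᵣ
  locᵣ-selects = record
    { resp = λ {S} {S′} {𝒫} {𝒫′} S≐ 𝒫≐ →
        Sum.map (locallyMaximal-resp {S} {S′} {𝒫} {𝒫′} S≐ 𝒫≐) (locallyMaximal-resp {S} {S′} {𝒫} {𝒫′} S≐ 𝒫≐)
    ; swap⁺ = Sum.swap
    ; dec = λ τ s → locallyMaximal? τ s ⊎-dec locallyMaximal? τ (swap s)
    ; ext⊆ = λ τ → Sum.map (extremal⇒locallyMaximal τ) (extremal⇒locallyMaximal τ)
    ; ⊆loc = λ _ → id
    }
    where
    locallyMaximal-resp : S ≐ S′ → 𝒫 ≐ 𝒫′ →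
                          LocallyMaximal (Relevant S 𝒫) 𝒫 ⊆ LocallyMaximal (Relevant S′ 𝒫′) 𝒫′
    locallyMaximal-resp {S} {S′} {𝒫} {𝒫′} S≐ 𝒫≐ (P , P∈ , m) =
      P , proj₁ 𝒫≐ P∈ , maximalIn-resp {P = P} {P} (relevant-≐ {S} {S′} {𝒫} {𝒫′} S≐ 𝒫≐) (id , id) m
    locallyMaximal? : Task S 𝒫 → Decidable (LocallyMaximal (Relevant S 𝒫) 𝒫)
    locallyMaximal? τ s =
      some-profile? τ (λ {P} {Q} e → maximalIn-resp {P = P} {Q} (id , id) (≗⇒⊆ e , ≗⇒⊆ (sym ∘ e)))
        (maximalIn? (relevant? τ) s)

  open Strategy extᵣ-selects

  -- A profile containing an extremal separation is determined on the relevant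
  -- separations, so each extremal separation uses up a profile of its own and
  -- at most one branch of the recursion is nontrivial.
  extStrategySet-cover : (τ : Task S 𝒫) →
    ∃[ xs ] StrategySet extᵣ S 𝒫 ⊆ (_∈ˡ xs) × length xs ≤ 2 * length (Task.profiles τ)
  extStrategySet-cover τ = go τ _ ≤-refl
    where
    go : ∀ {S 𝒫} (τ : Task S 𝒫) m → length (Task.profiles τ) < m →
         ∃[ xs ] StrategySet extᵣ S 𝒫 ⊆ (_∈ˡ xs) × length xs ≤ 2 * length (Task.profiles τ)
    go {S} {𝒫} τ (suc m) (s≤s le) with any-sep? (relevant? τ)
    ... | no ¬sat = [] , (λ { (select sat _) → ⊥-elim (¬sat sat) ; (recurse sat _ _ _) → ⊥-elim (¬sat sat) }) , z≤n
    ... | yes sat = combine (Any.any? (λ P → ¬? (containsExtremal? P)) profiles)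
      where
      open Task τ
      open Selects extᵣ-selects using (dec; swap⁺)

      R N E : Pred (Sep n) 0ℓ
      R = Relevant S 𝒫
      N = extᵣ S 𝒫
      E = Extremal R

      E? : Decidable E
      E? = extremal? (relevant? τ)

      ContainsExtremal : SepSet n → Set
      ContainsExtremal P = ∃[ e ] e ∈ E × e ∈ ⟦ P ⟧

      containsExtremal? : ∀ P → Dec (ContainsExtremal P)
      containsExtremal? P = any-sep? λ e → E? e ×-dec T? (P e)

      used : List (SepSet n)
      used = filter containsExtremal? profiles

      es : List (Sep n)
      es = proj₁ (listOf E?)

      es-E : (_∈ˡ es) ≐ E
      es-E = proj₂ (proj₂ (listOf E?))

      F : Sep n → SepSet n → Set
      F e P = P ∈ 𝒫 × e ∈ E × e ∈ ⟦ P ⟧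

      es≤used : length es ≤ length used
      -- Two extremal separations in one profile would both be its greatest relevant element.
      es≤used = pigeonhole {F = F} es used own
        (AllPairs.map (λ ne → λ { (P∈ , Ee , e∈P) (_ , Ee′ , e′∈P) →
          ne (≼-antisym (extremal⇒greatest τ Ee′ P∈ e′∈P e∈P (proj₁ Ee)) (extremal⇒greatest τ Ee P∈ e∈P e′∈P (proj₁ Ee′))) })
          (proj₁ (proj₂ (listOf E?))))
        where
        own : ∀ {e} → e ∈ˡ es → ∃[ P ] P ∈ˡ used × F e P
        own {e} m with proj₁ es-E m
        ... | Ee@((_ , (P , P∈ , e∈P) , _) , _) with complete P∈
        ...   | P′ , m′ , eq = P′ , ∈-filter⁺ containsExtremal? m′ (e , Ee , e∈P′) , sound m′ , Ee , e∈P′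
          where e∈P′ = ≗⇒⊆ (sym ∘ eq) e∈P

      cover : List (Sep n)
      cover = es ++ map swap es

      N⊆cover : N ⊆ (_∈ˡ cover)
      N⊆cover (inj₁ Ee) = ∈-++⁺ˡ (proj₂ es-E Ee)
      N⊆cover (inj₂ Ee) = ∈-++⁺ʳ es (∈-map⁺ swap (proj₂ es-E Ee))

      cover≤ : length cover ≤ 2 * length used
      cover≤ = begin
        length cover             ≡⟨ length-++ es ⟩
        length es + length (map swap es) ≡⟨ cong (length es +_) (length-map swap es) ⟩
        length es + length es    ≡⟨ cong (length es +_) (+-identityʳ _) ⟨
        2 * length es            ≤⟨ *-monoʳ-≤ 2 es≤used ⟩
        2 * length used          ∎
        where open ≤-Reasoning

      -- Profiles with a common extremal e agree on all relevant separations, as each of these or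
      -- its inverse lies below e. Hence the orientation O of a branch with an element contains no
      -- extremal separation.
      branch-free : ∀ {O s} → O ∈ ConsistentOrientation N →
                    s ∈ StrategySet extᵣ (restrictS S N O) (extending 𝒫 O) →
                    ∃[ P ] P ∈ˡ profiles × ⟦ O ⟧ ⊆ ⟦ P ⟧ × ¬ ContainsExtremal P
      branch-free {O} co d with strategySet⊆relevant (subtask τ O) d
      ... | (Ss , _) , (P , (P∈ , O⊆P) , s∈P) , (P′ , (P′∈ , O⊆P′) , s*∈P′) with complete P∈
      ...   | Q , mQ , eq = Q , mQ , (λ m → ≗⇒⊆ (sym ∘ eq) (O⊆P m)) , free
        where
        free : ¬ ContainsExtremal Q
        free (e , Ee@(_ , ext) , e∈Q) with oriented (orientation co) (inj₁ Ee)
        ... | inj₂ e*∈O = antisymmetric (orients P∈) (≗⇒⊆ eq e∈Q) (O⊆P e*∈O)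
        ... | inj₁ e∈O with ext (Ss , (P , P∈ , s∈P) , (P′ , P′∈ , s*∈P′))
        ...   | inj₁ s≼e = antisymmetric (orients P′∈) (downClosed (orients P′∈) Ss s≼e (O⊆P′ e∈O)) s*∈P′
        ...   | inj₂ s*≼e = antisymmetric (orients P∈) s∈P (downClosed (orients P∈) (S-swap Ss) s*≼e (≗⇒⊆ eq e∈Q))

      module Branch {Q : SepSet n} (mQ : Q ∈ˡ profiles) (free : ¬ ContainsExtremal Q) where

        O[Q] : SepSet n
        O[Q] = restrict (dec τ) Q

        O[Q]-co : O[Q] ∈ ConsistentOrientation N
        O[Q]-co = restrict-consistentOrientation (dec τ) swap⁺ (orientsN τ (sound mQ))

        -- Only one orientation of N contains the inverse of every extremal separation.
        only-branch : ∀ {O s} → O ∈ ConsistentOrientation N →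
                      s ∈ StrategySet extᵣ (restrictS S N O) (extending 𝒫 O) → ⟦ O ⟧ ≐ ⟦ O[Q] ⟧
        only-branch {O} co d with ≐-or-distinguishes (dec τ) swap⁺ co O[Q]-co
        ... | inj₁ e = e
        ... | inj₂ (r , Nr , r∈O , r*∈O[Q]) with branch-free co d | Nr
        ...   | P , _ , O⊆P , free′ | inj₁ Er = ⊥-elim (free′ (r , Er , O⊆P r∈O))
        ...   | P , _ , O⊆P , free′ | inj₂ Er* = ⊥-elim (free (swap r , Er* , proj₂ (restrict⁻ (dec τ) {P = Q} r*∈O[Q])))

        rest : List (SepSet n)
        rest = filter (O[Q] ⊆ˢ?_) profiles

        Uses : Bool → SepSet n → Set
        Uses true P = ContainsExtremal P
        Uses false P = ⟦ O[Q] ⟧ ⊆ ⟦ P ⟧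

        uses? : ∀ b P → Dec (Uses b P)
        uses? true = containsExtremal?
        uses? false = O[Q] ⊆ˢ?_

        disjoint : DisjointOn Uses profiles true false
        disjoint mP (e , Ee , e∈P) O⊆P = antisymmetric (orients (sound mP)) e∈P
          (O⊆P (restrict⁺ (dec τ) {P = Q} (inj₂ Ee)
            (complement (orientsN τ (sound mQ)) (inj₁ Ee) (λ e∈Q → free (e , Ee , e∈Q)))))

        used+rest≤ : length used + length rest ≤ length profiles
        used+rest≤ = ≤-trans
          (≤-reflexive (cong (length used +_) (sym (+-identityʳ _))))
          -- The two kinds of profiles are counted as the two rows of one double count.
          (sum-length-filter≤ uses? (true ∷ false ∷ []) profiles (((λ {P} → disjoint {P}) ∷ []) ∷ [] ∷ []))

        branch : ∃[ zs ] StrategySet extᵣ (restrictS S N O[Q]) (extending 𝒫 O[Q]) ⊆ (_∈ˡ zs) ×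
                 length zs ≤ 2 * length rest
        branch = go (subtask τ O[Q]) m (≤-trans (subtask-shrinks τ (proj₂ (selected-exists τ sat)) O[Q]-co) le)

        extend : (∃[ zs ] StrategySet extᵣ (restrictS S N O[Q]) (extending 𝒫 O[Q]) ⊆ (_∈ˡ zs) ×
                    length zs ≤ 2 * length rest) →
                 ∃[ xs ] StrategySet extᵣ S 𝒫 ⊆ (_∈ˡ xs) × length xs ≤ 2 * length profiles
        extend (zs , ⊆zs , zs≤) = cover ++ zs , inc , bound
          where
          inc : StrategySet extᵣ S 𝒫 ⊆ (_∈ˡ (cover ++ zs))
          inc (select _ Ns) = ∈-++⁺ˡ (N⊆cover Ns)
          inc (recurse _ O co d) = ∈-++⁺ʳ cover (⊆zs (subtask-resp (only-branch co d) d))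
          open ≤-Reasoning
          bound : length (cover ++ zs) ≤ 2 * length profiles
          bound = begin
            length (cover ++ zs)               ≡⟨ length-++ cover ⟩
            length cover + length zs           ≤⟨ +-mono-≤ cover≤ zs≤ ⟩
            2 * length used + 2 * length rest  ≡⟨ *-distribˡ-+ 2 (length used) _ ⟨
            2 * (length used + length rest)    ≤⟨ *-monoʳ-≤ 2 used+rest≤ ⟩
            2 * length profiles                ∎

        result : ∃[ xs ] StrategySet extᵣ S 𝒫 ⊆ (_∈ˡ xs) × length xs ≤ 2 * length profiles
        result = extend branch

      combine : Dec (Any.Any (λ P → ¬ ContainsExtremal P) profiles) →
                ∃[ xs ] StrategySet extᵣ S 𝒫 ⊆ (_∈ˡ xs) × length xs ≤ 2 * length profiles
      combine (yes a) with find a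
      ... | Q , mQ , free = Branch.result mQ free
      combine (no ¬a) = cover , inc , ≤-trans cover≤ (*-monoʳ-≤ 2 (length-filter containsExtremal? profiles))
        where
        inc : StrategySet extᵣ S 𝒫 ⊆ (_∈ˡ cover)
        inc (select _ Ns) = N⊆cover Ns
        inc (recurse _ O co d) with branch-free co d
        ... | P , mP , _ , free = ⊥-elim (¬a (lose mP free))

-- Corners of separations

module _ {n : ℕ} where

  private
    variable
      r s t u : Sep n

  join : Sep n → Sep n → Sep n
  join (A , B) (C , D) = A ∪ C , B ∩ D

  ≼-joinˡ : s ≼ join s t
  ≼-joinˡ {A , B} {C , D} = Subset.p⊆p∪q C , Subset.p∩q⊆p B D

  ≼-joinʳ : t ≼ join s t
  ≼-joinʳ {C , D} {A , B} = Subset.q⊆p∪q A C , Subset.p∩q⊆q B D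

  join-least : s ≼ u → t ≼ u → join s t ≼ u
  join-least {A , B} {E , F} {C , D} (a , b) (c , d) =
    (λ m → [ a , c ]′ (Subset.x∈p∪q⁻ A C m)) , λ m → Subset.x∈p∩q⁺ (b m , d m)

  -- The fish lemma. Only when r lies between s and t does the corner give no relation directly, and
  -- then s and t would be nested.
  join-nested : Nested r s → Nested r t → ¬ Nested s t → Nested r (join s t)
  join-nested {s = s} {t} rs rt s∦t with rs | rt
  ... | inj₁ (inj₁ r≼s) | _ = inj₁ (inj₁ (≼-trans r≼s (≼-joinˡ {s} {t})))
  ... | inj₂ (inj₂ s*≼r) | _ = inj₂ (inj₂ (≼-trans (≼-swap (≼-joinˡ {s} {t})) s*≼r))
  ... | _ | inj₁ (inj₁ r≼t) = inj₁ (inj₁ (≼-trans r≼t (≼-joinʳ {t} {s})))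
  ... | _ | inj₂ (inj₂ t*≼r) = inj₂ (inj₂ (≼-trans (≼-swap (≼-joinʳ {t} {s})) t*≼r))
  ... | inj₁ (inj₂ s≼r) | inj₁ (inj₂ t≼r) = inj₁ (inj₂ (join-least s≼r t≼r))
  ... | inj₁ (inj₂ s≼r) | inj₂ (inj₁ r≼t*) = ⊥-elim (s∦t (inj₂ (inj₁ (≼-trans s≼r r≼t*))))
  ... | inj₂ (inj₁ r≼s*) | inj₁ (inj₂ t≼r) = ⊥-elim (s∦t (inj₂ (inj₁ (≼-swap (≼-trans t≼r r≼s*)))))
  ... | inj₂ (inj₁ r≼s*) | inj₂ (inj₁ r≼t*) = inj₂ (inj₁ (≼-swap (join-least (≼-swap r≼s*) (≼-swap r≼t*))))

  order-swap : (s : Sep n) → order (swap s) ≡ order s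
  order-swap (A , B) = cong ∣_∣ (Subset.∩-comm B A)

-- Every vertex contributes equally to both sides; the cases closed by `()` are vertices outside
-- `A ∪ B` or `C ∪ D`.
submodular : ∀ {n} (A B C D : Subset n) → A ∪ B ≡ ⊤ → C ∪ D ≡ ⊤ →
             ∣ (A ∪ C) ∩ (B ∩ D) ∣ + ∣ (B ∪ D) ∩ (A ∩ C) ∣ ≡ ∣ A ∩ B ∣ + ∣ C ∩ D ∣
submodular [] [] [] [] _ _ = refl
submodular (false ∷ A) (false ∷ B) (c ∷ C) (d ∷ D) () q
submodular (true ∷ A) (b ∷ B) (false ∷ C) (false ∷ D) p ()
submodular (false ∷ A) (true ∷ B) (false ∷ C) (false ∷ D) p ()
submodular (true ∷ A) (true ∷ B) (true ∷ C) (true ∷ D) p q =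
  cong suc (trans (+-suc _ _)
    (trans (cong suc (submodular A B C D (Vec.∷-injectiveʳ p) (Vec.∷-injectiveʳ q))) (sym (+-suc _ _))))
submodular (true ∷ A) (true ∷ B) (true ∷ C) (false ∷ D) p q =
  trans (+-suc _ _) (cong suc (submodular A B C D (Vec.∷-injectiveʳ p) (Vec.∷-injectiveʳ q)))
submodular (true ∷ A) (true ∷ B) (false ∷ C) (true ∷ D) p q =
  cong suc (submodular A B C D (Vec.∷-injectiveʳ p) (Vec.∷-injectiveʳ q))
submodular (true ∷ A) (false ∷ B) (true ∷ C) (true ∷ D) p q =
  trans (+-suc _ _) (trans (cong suc (submodular A B C D (Vec.∷-injectiveʳ p) (Vec.∷-injectiveʳ q))) (sym (+-suc _ _)))
submodular (false ∷ A) (true ∷ B) (true ∷ C) (true ∷ D) p q =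
  trans (cong suc (submodular A B C D (Vec.∷-injectiveʳ p) (Vec.∷-injectiveʳ q))) (sym (+-suc _ _))
submodular (true ∷ A) (false ∷ B) (true ∷ C) (false ∷ D) p q =
  submodular A B C D (Vec.∷-injectiveʳ p) (Vec.∷-injectiveʳ q)
submodular (true ∷ A) (false ∷ B) (false ∷ C) (true ∷ D) p q =
  submodular A B C D (Vec.∷-injectiveʳ p) (Vec.∷-injectiveʳ q)
submodular (false ∷ A) (true ∷ B) (true ∷ C) (false ∷ D) p q =
  submodular A B C D (Vec.∷-injectiveʳ p) (Vec.∷-injectiveʳ q)
submodular (false ∷ A) (true ∷ B) (false ∷ C) (true ∷ D) p q =
  submodular A B C D (Vec.∷-injectiveʳ p) (Vec.∷-injectiveʳ q)

-- Separations of a graph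

x∈p─q⇒x∉q : ∀ {n} {x : Fin n} (p q : Subset n) → x ∈ᵥ p ─ q → x ∉ᵥ q
x∈p─q⇒x∉q (_ ∷ p) (_ ∷ q) (there m) (there m′) = x∈p─q⇒x∉q p q m m′

module GraphSeparations {n : ℕ} (G : Graph n) where
  open Graph G

  private
    variable
      s t : Sep n
      P Q : SepSet n
      m ℓ : ℕ

  separation? : Decidable (IsSeparation G)
  separation? (A , B) = Vec.≡-dec Bool._≟_ (A ∪ B) ⊤ ×-dec
    map′ (λ f {u} {v} → f u v) (λ f u v → f {u} {v})
      (Fin.all? λ u → Fin.all? λ v →
        →-dec (u Subset.∈? (A ─ B)) (→-dec (v Subset.∈? (B ─ A)) (¬? (adj? u v))))

  separation-swap : IsSeparation G s → IsSeparation G (swap s)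
  separation-swap {A , B} (eq , na) = trans (Subset.∪-comm B A) eq , λ u∈ v∈ a → na v∈ u∈ (adj-sym a)

  ∈-∪-cover : ∀ {x : Fin n} {A B} → A ∪ B ≡ ⊤ → x ∉ᵥ A → x ∈ᵥ B
  ∈-∪-cover {x} {A} {B} eq x∉A =
    [ (λ x∈A → contradiction x∈A x∉A) , id ]′ (Subset.x∈p∪q⁻ A B (subst (x ∈ᵥ_) (sym eq) Subset.∈⊤))

  -- An edge across the corner would also cross s or t, according to which of B and D its end u
  -- misses.
  separation-join : IsSeparation G s → IsSeparation G t → IsSeparation G (join s t)
  separation-join {A , B} {C , D} (eq , na) (eq′ , na′) =
    Subset.⊆-antisym (λ _ → Subset.∈⊤) (λ {x} _ → covers x) , noEdge
    where
    covers : ∀ x → x ∈ᵥ (A ∪ C) ∪ (B ∩ D)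
    covers x with x Subset.∈? A | x Subset.∈? C
    ... | yes x∈A | _ = Subset.x∈p∪q⁺ (inj₁ (Subset.x∈p∪q⁺ (inj₁ x∈A)))
    ... | no _ | yes x∈C = Subset.x∈p∪q⁺ (inj₁ (Subset.x∈p∪q⁺ (inj₂ x∈C)))
    ... | no x∉A | no x∉C = Subset.x∈p∪q⁺ (inj₂ (Subset.x∈p∩q⁺ (∈-∪-cover eq x∉A , ∈-∪-cover eq′ x∉C)))
    noEdge : ∀ {u v} → u ∈ᵥ (A ∪ C) ─ (B ∩ D) → v ∈ᵥ (B ∩ D) ─ (A ∪ C) → ¬ Adj u v
    noEdge {u} {v} u∈ v∈ = split (u Subset.∈? B)
      where
      u∉ = x∈p─q⇒x∉q (A ∪ C) (B ∩ D) u∈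
      v∉ = x∈p─q⇒x∉q (B ∩ D) (A ∪ C) v∈
      v∈BD = Subset.x∈p∩q⁻ B D (Subset.p─q⊆p (B ∩ D) (A ∪ C) v∈)
      swap-cover : ∀ {x A B} → A ∪ B ≡ ⊤ → x ∉ᵥ B → x ∈ᵥ A
      swap-cover {A = A} {B} e = ∈-∪-cover (trans (Subset.∪-comm B A) e)
      split : Dec (u ∈ᵥ B) → ¬ Adj u v
      split (no u∉B) = na (Subset.x∈p∧x∉q⇒x∈p─q (swap-cover eq u∉B) u∉B)
        (Subset.x∈p∧x∉q⇒x∈p─q (proj₁ v∈BD) (λ v∈A → v∉ (Subset.x∈p∪q⁺ (inj₁ v∈A))))
      split (yes u∈B) = na′ (Subset.x∈p∧x∉q⇒x∈p─q (swap-cover eq′ u∉D) u∉D)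
        (Subset.x∈p∧x∉q⇒x∈p─q (proj₂ v∈BD) (λ v∈C → v∉ (Subset.x∈p∪q⁺ (inj₂ v∈C))))
        where u∉D = λ u∈D → u∉ (Subset.x∈p∩q⁺ (u∈B , u∈D))

  order-join : IsSeparation G s → IsSeparation G t →
               order (join s t) + order (join (swap s) (swap t)) ≡ order s + order t
  order-join {A , B} {C , D} (eq , _) (eq′ , _) = submodular A B C D eq eq′

  Below : ℕ → Pred (Sep n) 0ℓ
  Below ℓ s = IsSeparation G s × order s < ℓ

  below? : ∀ ℓ → Decidable (Below ℓ)
  below? ℓ s = separation? s ×-dec (order s <? ℓ)

  below-swap : s ∈ Below ℓ → swap s ∈ Below ℓ
  below-swap {s = s} {ℓ} (sep , lt) = separation-swap sep , subst (_< ℓ) (sym (order-swap s)) lt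

  below-mono : m ≤ ℓ → Below m ⊆ Below ℓ
  below-mono m≤ℓ (sep , lt) = sep , ≤-trans lt m≤ℓ

  profile⇒consistentOrientation : P ∈ IsProfile G ℓ → P ∈ ConsistentOrientation (Below ℓ)
  profile⇒consistentOrientation p = IsProfileOf.orients p , IsProfileOf.consistent p

  profile⇒orientation : P ∈ IsProfile G ℓ → Orientation (Below ℓ) P
  profile⇒orientation {P} p = orientation {O = P} (profile⇒consistentOrientation p)

  restrict-profile : m ≤ ℓ → P ∈ IsProfile G ℓ → restrict (below? m) P ∈ IsProfile G m
  restrict-profile {m} {ℓ} {P} m≤ℓ p = record
    { orients = proj₁ co ; consistent = proj₂ co
    ; profile = λ a b c → IsProfileOf.profile p (restrict⇒ a) (restrict⇒ b) (restrict⇒ c) }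
    where
    restrict⇒ : ∀ {s} → s ∈ ⟦ restrict (below? m) P ⟧ → s ∈ ⟦ P ⟧
    restrict⇒ x = proj₂ (restrict⁻ (below? m) {P = P} x)
    o : Orientation (Below m) P
    o = record { oriented = λ b → oriented (profile⇒orientation p) (below-mono m≤ℓ b) ; consistent = IsProfileOf.consistent p }
    co : restrict (below? m) P ∈ ConsistentOrientation (Below m)
    co = restrict-consistentOrientation (below? m) below-swap o

  profile-join : P ∈ IsProfile G ℓ → s ∈ ⟦ P ⟧ → t ∈ ⟦ P ⟧ → order (join s t) < ℓ → join s t ∈ ⟦ P ⟧
  profile-join {P} {ℓ} {s} {t} p s∈P t∈P lt =
    [ id , (λ j*∈P → ⊥-elim (IsProfileOf.profile p {proj₁ s} {proj₂ s} {proj₁ t} {proj₂ t} s∈P t∈P j*∈P)) ]′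
      (oriented (profile⇒orientation p)
        (separation-join (proj₁ (proj₁ (IsProfileOf.orients p) s∈P)) (proj₁ (proj₁ (IsProfileOf.orients p) t∈P)) , lt))

  -- If one side contains the other, s is comparable with its own inverse, and consistency of a
  -- profile with itself allows only one orientation.
  distinguished⇒proper : Consistent ⟦ P ⟧ → Consistent ⟦ Q ⟧ → s ∈ ⟦ P ⟧ → swap s ∈ ⟦ Q ⟧ → Proper s
  distinguished⇒proper cP cQ s∈P s*∈Q = (λ A⊆B → cQ s*∈Q s*∈Q (A⊆B , A⊆B)) , (λ B⊆A → cP s∈P s∈P (B⊆A , B⊆A))

  -- A path that starts in `A ─ B` and avoids `A ∩ B` never leaves `A ─ B`.
  proper⇒separates : IsSeparation G s → Proper s → Separates G (proj₁ s ∩ proj₂ s)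
  proper⇒separates {A , B} (eq , na) (A⊈B , B⊈A) with witness A B A⊈B | witness B A B⊈A
    where
    witness : ∀ (C D : Subset n) → ¬ (C ⊆ᵥ D) → ∃[ x ] x ∈ᵥ C × x ∉ᵥ D
    witness C D C⊈D with Fin.any? (λ x → x Subset.∈? C ×-dec ¬? (x Subset.∈? D))
    ... | yes w = w
    ... | no ¬w = ⊥-elim (C⊈D λ {x} x∈C → decidable-stable (x Subset.∈? D) λ x∉D → ¬w (x , x∈C , x∉D))
  ... | u , u∈A , u∉B | v , v∈B , v∉A =
    u , v , (λ m → u∉B (proj₂ (Subset.x∈p∩q⁻ A B m))) , (λ m → v∉A (proj₁ (Subset.x∈p∩q⁻ A B m))) ,
    λ path → v∉A (proj₁ (stays path (u∈A , u∉B)))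
    where
    stays : ∀ {x y} → Star (λ x y → Adj x y × x ∉ᵥ A ∩ B × y ∉ᵥ A ∩ B) x y →
            x ∈ᵥ A × x ∉ᵥ B → y ∈ᵥ A × y ∉ᵥ B
    stays ε x∈ = x∈
    stays (_◅_ {j = y} (adj , _ , y∉) path) (x∈A , x∉B) with y Subset.∈? B
    ... | no y∉B = stays path (∈-∪-cover (trans (Subset.∪-comm B A) eq) y∉B , y∉B)
    ... | yes y∈B = ⊥-elim (na (Subset.x∈p∧x∉q⇒x∈p─q x∈A x∉B)
      (Subset.x∈p∧x∉q⇒x∈p─q y∈B (λ y∈A → y∉ (Subset.x∈p∩q⁺ (y∈A , y∈B)))) adj)

-- Iterated strategies

module _ {n : ℕ} where

  _≗?_ : (P Q : SepSet n) → Dec (P ≗ Q)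
  P ≗? Q = all-seps? λ s → P s Bool.≟ Q s

  distinguishes-sym : ∀ {X : Pred (Sep n) 0ℓ} {P Q} → (∀ {s} → s ∈ X → swap s ∈ X) →
                      Distinguishes X P Q → Distinguishes X Q P
  distinguishes-sym X-swap (s , Xs , s∈P , s*∈Q) = swap s , X-swap Xs , s*∈Q , s∈P

-- Uncrossing separations of different orders

module Corners {n : ℕ} (G : Graph n) where
  open GraphSeparations G

  private
    variable
      s t u : Sep n
      P Q K L : SepSet n
      k ℓ : ℕ

  Separator : ℕ → SepSet n → SepSet n → Pred (Sep n) 0ℓ
  Separator ℓ P Q s = IsSeparation G s × order s ≡ ℓ × s ∈ ⟦ P ⟧ × swap s ∈ ⟦ Q ⟧

  separator-swap : s ∈ Separator ℓ P Q → swap s ∈ Separator ℓ Q P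
  separator-swap {s} (sep , eq , s∈P , s*∈Q) = separation-swap sep , trans (order-swap s) eq , s*∈Q , s∈P

  undistinguished⇒≤order : ¬ Distinguishes (Below ℓ) P Q → IsSeparation G s →
                           s ∈ ⟦ P ⟧ → swap s ∈ ⟦ Q ⟧ → ℓ ≤ order s
  undistinguished⇒≤order ¬d sep s∈P s*∈Q = ≮⇒≥ λ lt → ¬d (_ , (sep , lt) , s∈P , s*∈Q)

  -- The profile property puts the join into P, and down-closure puts its inverse into Q. As nothing
  -- of order below ℓ distinguishes the two, the order is exactly ℓ.
  join-separator : P ∈ IsProfile G (suc ℓ) → Q ∈ IsProfile G (suc ℓ) → ¬ Distinguishes (Below ℓ) P Q →
                   s ∈ Separator ℓ P Q → IsSeparation G t → t ∈ ⟦ P ⟧ → order (join s t) ≤ ℓ →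
                   join s t ∈ Separator ℓ P Q
  join-separator {P} {ℓ} {Q} {s} {t} p q ¬d (sep , _ , s∈P , s*∈Q) sep′ t∈P le =
    sepᵤ , ≤-antisym le (undistinguished⇒≤order {P = P} {Q} ¬d sepᵤ u∈P u*∈Q) , u∈P , u*∈Q
    where
    sepᵤ : IsSeparation G (join s t)
    sepᵤ = separation-join sep sep′
    u∈P : join s t ∈ ⟦ P ⟧
    u∈P = profile-join p s∈P t∈P (s≤s le)
    u*∈Q : swap (join s t) ∈ ⟦ Q ⟧
    u*∈Q = downClosed (profile⇒orientation q) (below-swap (sepᵤ , s≤s le)) (≼-swap (≼-joinˡ {s = s} {t})) s*∈Q

  -- If the corner join s t had order greater than ℓ then the opposite corner
  -- would distinguish K from L, and do so with smaller order than t.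
  order-join≤ : suc ℓ ≤ k → K ∈ IsProfile G k → L ∈ IsProfile G k → ¬ Distinguishes (Below (order t)) K L →
                IsSeparation G s → order s ≡ ℓ → IsSeparation G t → order t < ℓ →
                t ∈ ⟦ K ⟧ → swap t ∈ ⟦ L ⟧ → swap s ∈ ⟦ L ⟧ → order (join s t) ≤ ℓ
  order-join≤ {ℓ} {k} {K} {L} {t} {s} ℓ<k pK pL ¬d sep refl sep′ t<ℓ t∈K t*∈L s*∈L with order (join s t) ≤? ℓ
  ... | yes le = le
  ... | no ¬le = ⊥-elim (¬d (swap w , below-swap (sepw , w<t) , w*∈K , w∈L))
    where
    w : Sep n
    w = join (swap s) (swap t)
    sepw : IsSeparation G w
    sepw = separation-join (separation-swap sep) (separation-swap sep′)
    w<t : order w < order t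
    w<t with order w <? order t
    ... | yes lt = lt
    ... | no ¬lt = ⊥-elim (<-irrefl (sym (order-join sep sep′)) (+-mono-<-≤ (≰⇒> ¬le) (≮⇒≥ ¬lt)))
    w<k : order w < k
    w<k = <-trans w<t (<-trans t<ℓ ℓ<k)
    w∈L : w ∈ ⟦ L ⟧
    w∈L = profile-join pL s*∈L t*∈L w<k
    w*∈K : swap w ∈ ⟦ K ⟧
    w*∈K = downClosed (profile⇒orientation pK) (below-swap (sepw , w<k)) (≼-swap (≼-joinʳ {t = swap t} {swap s})) t∈K

  -- The last clause ensures that repeated uncrossing loses no nestedness already achieved.
  Corner : ℕ → SepSet n → SepSet n → Sep n → Sep n → Set
  Corner ℓ P Q s t = ∃[ u ] u ∈ Separator ℓ P Q × Nested u t ×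
    (∀ {r} → Nested r s → Nested r t → Nested r u)

  -- In usual terms, t distinguishes K and L efficiently. K and L are taken from 𝒫 itself because
  -- they must also orient the separation of larger order that is to be uncrossed from t.
  Efficient : Pred (SepSet n) 0ℓ → Pred (Sep n) 0ℓ
  Efficient 𝒫 t = IsSeparation G t × (∃[ K ] ∃[ L ] K ∈ 𝒫 × L ∈ 𝒫 ×
    t ∈ ⟦ K ⟧ × swap t ∈ ⟦ L ⟧ × ¬ Distinguishes (Below (order t)) K L)

  efficient-swap : ∀ {𝒫} → t ∈ Efficient 𝒫 → swap t ∈ Efficient 𝒫
  efficient-swap {t} (sep , K , L , K∈ , L∈ , t∈K , t*∈L , ¬d) =
    separation-swap sep , L , K , L∈ , K∈ , t*∈L , t∈K ,
    λ d → ¬d (subst (λ m → Distinguishes (Below m) K L) (order-swap t) (distinguishes-sym below-swap d))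

  module _ {𝒫 : Pred (SepSet n) 0ℓ} (𝒫⊆ : 𝒫 ⊆ IsProfile G k) (ℓ<k : suc ℓ ≤ k)
    (p : P ∈ IsProfile G (suc ℓ)) (q : Q ∈ IsProfile G (suc ℓ)) (¬d : ¬ Distinguishes (Below ℓ) P Q)
    where

    -- As t lies in both P and Q, it can be joined to s or to `swap s`. Which of these corners has
    -- small order depends on how L, which contains `swap t`, orients s.
    corner-in : s ∈ Separator ℓ P Q → ¬ Nested s t → t ∈ Efficient 𝒫 → order t < ℓ →
                t ∈ ⟦ P ⟧ → t ∈ ⟦ Q ⟧ → Corner ℓ P Q s t
    corner-in {s} {t} d@(sep , eq , _) s∦t (sep′ , K , L , K∈ , L∈ , t∈K , t*∈L , ¬dKL) t<ℓ t∈P t∈Q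
      with oriented (profile⇒orientation (𝒫⊆ L∈)) (sep , subst (_< k) (sym eq) ℓ<k)
    ... | inj₂ s*∈L =
      join s t ,
      join-separator p q ¬d d sep′ t∈P
        (order-join≤ {K = K} {L} ℓ<k (𝒫⊆ K∈) (𝒫⊆ L∈) ¬dKL sep eq sep′ t<ℓ t∈K t*∈L s*∈L) ,
      inj₁ (inj₂ (≼-joinʳ {t = t} {s})) , λ rs rt → join-nested rs rt s∦t
    ... | inj₁ s∈L =
      swap (join (swap s) t) ,
      separator-swap {P = Q} {P} (join-separator q p (¬d ∘ distinguishes-sym below-swap) (separator-swap {P = P} {Q} d) sep′ t∈Q
        (order-join≤ {K = K} {L} ℓ<k (𝒫⊆ K∈) (𝒫⊆ L∈) ¬dKL
          (separation-swap sep) (trans (order-swap s) eq) sep′ t<ℓ t∈K t*∈L s∈L)) ,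
      nested-swapˡ (inj₁ (inj₂ (≼-joinʳ {t = t} {swap s}))) ,
      λ rs rt → nested-swapʳ (join-nested (nested-swapʳ rs) rt (s∦t ∘ nested-swapˡ))

    corner : s ∈ Separator ℓ P Q → ¬ Nested s t → t ∈ Efficient 𝒫 → order t < ℓ → Corner ℓ P Q s t
    corner {s} {t} d s∦t e@(sep′ , _) t<ℓ
      with oriented (profile⇒orientation p) (sep′ , <-trans t<ℓ (n<1+n ℓ))
         | oriented (profile⇒orientation q) (sep′ , <-trans t<ℓ (n<1+n ℓ))
    ... | inj₁ t∈P | inj₁ t∈Q = corner-in d s∦t e t<ℓ t∈P t∈Q
    ... | inj₁ t∈P | inj₂ t*∈Q = ⊥-elim (¬d (t , (sep′ , t<ℓ) , t∈P , t*∈Q))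
    ... | inj₂ t*∈P | inj₁ t∈Q = ⊥-elim (¬d (swap t , below-swap (sep′ , t<ℓ) , t*∈P , t∈Q))
    ... | inj₂ t*∈P | inj₂ t*∈Q
      with corner-in d (s∦t ∘ nested-swapʳ) (efficient-swap {𝒫 = 𝒫} e) (subst (_< ℓ) (sym (order-swap t)) t<ℓ) t*∈P t*∈Q
    ...   | u , du , nest , pres = u , du , nested-swapʳ nest , λ rs rt → pres rs (nested-swapʳ rt)

    -- Elements of N are nested with each other, so replacing s by a corner with one of them keeps
    -- the others that were nested with s; after one pass through the list nothing crosses.
    uncross : (N : Pred (Sep n) 0ℓ) → (∀ {s t} → s ∈ N → t ∈ N → Nested s t) →
              (∀ {t} → t ∈ N → t ∈ Efficient 𝒫 × order t < ℓ) →
              (xs : List (Sep n)) → (∀ {t} → t ∈ˡ xs → t ∈ N) → s ∈ Separator ℓ P Q →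
              ∃[ u ] u ∈ Separator ℓ P Q × (∀ {t} → t ∈ˡ xs → Nested u t) ×
                     (∀ {r} → r ∈ N → Nested r s → Nested r u)
    uncross N nested eff [] inc d = _ , d , (λ ()) , λ _ nest → nest
    uncross {s} N nested eff (t ∷ xs) inc d = continue step
      where
      step : Corner ℓ P Q s t ⊎ Nested s t
      step with nested? s t
      ... | yes nest = inj₂ nest
      ... | no s∦t = inj₁ (corner d s∦t (proj₁ (eff (inc (here refl)))) (proj₂ (eff (inc (here refl)))))
      Result : Set
      Result = ∃[ u ] u ∈ Separator ℓ P Q × (∀ {r} → r ∈ˡ t ∷ xs → Nested u r) ×
                      (∀ {r} → r ∈ N → Nested r s → Nested r u)
      continue : Corner ℓ P Q s t ⊎ Nested s t → Result
      continue (inj₂ nest) with uncross N nested eff xs (inc ∘ there) d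
      ... | u , du , nests , pres =
        u , du , (λ { (here refl) → nested-sym (pres (inc (here refl)) (nested-sym nest)) ; (there m) → nests m }) , pres
      continue (inj₁ (v , dv , nest , presᵥ)) with uncross N nested eff xs (inc ∘ there) dv
      ... | u , du , nests , pres =
        u , du , (λ { (here refl) → nested-sym (pres (inc (here refl)) (nested-sym nest)) ; (there m) → nests m }) ,
        λ Nr rs → pres Nr (presᵥ rs (nested Nr (inc (here refl))))

-- The levels of an iterated strategy

module Iterated {n : ℕ} (G : Graph n) {k : ℕ} {𝒫 : Pred (SepSet n) 0ℓ} (𝒫⊆ : 𝒫 ⊆ IsProfile G k)
  (Ps : List (SepSet n)) (Ps-sound : ∀ {P} → P ∈ˡ Ps → P ∈ 𝒫)
  (Ps-complete : ∀ {P} → P ∈ 𝒫 → ∃[ Q ] Q ∈ˡ Ps × Q ≗ P)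
  {P₀ : SepSet n} (P₀∈ : P₀ ∈ˡ Ps)
  where
  open GraphSeparations G
  open Corners G

  private
    variable
      s t u : Sep n
      P Q : SepSet n
      ℓ : ℕ

  atLevel : ℕ → SepSet n → SepSet n
  atLevel ℓ = restrict (below? ℓ)

  atLevel⁻ : s ∈ ⟦ atLevel ℓ P ⟧ → s ∈ Below ℓ × s ∈ ⟦ P ⟧
  atLevel⁻ {ℓ = ℓ} {P} = restrict⁻ (below? ℓ) {P = P}

  atLevel-profile : ℓ ≤ k → P ∈ 𝒫 → atLevel ℓ P ∈ profilesAt G 𝒫 ℓ
  atLevel-profile {zero} {P} ℓ≤k P∈ m = case proj₂ (proj₁ (atLevel⁻ {P = P} m)) of λ ()
  atLevel-profile {suc ℓ} {P} ℓ≤k P∈ = restrict-profile ℓ≤k (𝒫⊆ P∈) , P , P∈ , λ m → proj₂ (atLevel⁻ {P = P} m)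

  profilesAt⇒consistentOrientation : ∀ ℓ → P ∈ profilesAt G 𝒫 ℓ → P ∈ ConsistentOrientation (Below ℓ)
  profilesAt⇒consistentOrientation zero empty =
    ((λ m → ⊥-elim (empty m)) , λ { (_ , ()) }) , λ m _ _ → empty m
  profilesAt⇒consistentOrientation (suc ℓ) (p , _) = profile⇒consistentOrientation p

  profilesAt⇒orientation : ∀ ℓ → P ∈ profilesAt G 𝒫 ℓ → Orientation (Below ℓ) P
  profilesAt⇒orientation {P} ℓ p = orientation {O = P} (profilesAt⇒consistentOrientation ℓ p)

  extends : ∀ ℓ → P ∈ profilesAt G 𝒫 ℓ → ∃[ K ] K ∈ 𝒫 × ⟦ P ⟧ ⊆ ⟦ K ⟧
  -- The empty profile lies in any member of 𝒫, but there has to be one.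
  extends zero empty = P₀ , Ps-sound P₀∈ , λ m → ⊥-elim (empty m)
  extends (suc ℓ) (_ , ext) = ext

  ≐-or-distinguished : ∀ ℓ → P ∈ profilesAt G 𝒫 ℓ → Q ∈ profilesAt G 𝒫 ℓ →
                       ⟦ P ⟧ ≐ ⟦ Q ⟧ ⊎ Distinguishes (Below ℓ) P Q
  ≐-or-distinguished {P} {Q} ℓ p q = ≐-or-distinguishes {O = P} {Q} (below? ℓ) below-swap
    (profilesAt⇒consistentOrientation ℓ p) (profilesAt⇒consistentOrientation ℓ q)

  subset-≐ : ∀ ℓ {K} → K ∈ 𝒫 → P ∈ profilesAt G 𝒫 ℓ → Q ∈ profilesAt G 𝒫 ℓ →
             ⟦ P ⟧ ⊆ ⟦ K ⟧ → ⟦ Q ⟧ ⊆ ⟦ K ⟧ → ⟦ P ⟧ ≐ ⟦ Q ⟧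
  subset-≐ ℓ K∈ p q P⊆K Q⊆K with ≐-or-distinguished ℓ p q
  ... | inj₁ e = e
  ... | inj₂ (r , _ , r∈P , r*∈Q) = ⊥-elim (antisymmetric (profile⇒orientation (𝒫⊆ K∈)) (P⊆K r∈P) (Q⊆K r*∈Q))

  levelProfiles : ℕ → List (SepSet n)
  levelProfiles ℓ = deduplicate _≗?_ (map (atLevel ℓ) Ps)

  levelProfiles-sound : ℓ ≤ k → P ∈ˡ levelProfiles ℓ → P ∈ profilesAt G 𝒫 ℓ
  levelProfiles-sound {ℓ} ℓ≤k m with ∈-map⁻ (atLevel ℓ) (∈-deduplicate⁻ _≗?_ (map (atLevel ℓ) Ps) m)
  ... | P , mP , refl = atLevel-profile ℓ≤k (Ps-sound mP)

  -- An ℓ-profile inside a k-profile K is the restriction of K, because two of them inside K cannot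
  -- be distinguished.
  levelProfiles-complete : ∀ ℓ → ℓ ≤ k → Q ∈ profilesAt G 𝒫 ℓ → ∃[ P ] P ∈ˡ levelProfiles ℓ × P ≗ Q
  levelProfiles-complete {Q} ℓ ℓ≤k q with extends ℓ q
  ... | K , K∈ , Q⊆K with Ps-complete K∈
  ... | K′ , mK′ , eq with deduplicate-represents _≗?_ (λ _ → refl) (λ e e′ s → trans (e s) (e′ s)) (∈-map⁺ (atLevel ℓ) mK′)
  ... | P , mP , e = P , mP , λ s → trans (e s) (≐⇒≗ {P = atLevel ℓ K′} {Q} same s)
    where
    same : ⟦ atLevel ℓ K′ ⟧ ≐ ⟦ Q ⟧
    same = subset-≐ ℓ K∈ (atLevel-profile ℓ≤k (Ps-sound mK′)) q
      (λ m → ≗⇒⊆ {P = K′} {K} eq (proj₂ (atLevel⁻ {P = K′} m))) Q⊆K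

  length-levelProfiles≤ : ∀ ℓ → length (levelProfiles ℓ) ≤ length Ps
  length-levelProfiles≤ ℓ =
    ≤-trans (length-deduplicate≤ _≗?_ (map (atLevel ℓ) Ps)) (≤-reflexive (length-map (atLevel ℓ) Ps))

  module _ {N : Pred (Sep n) 0ℓ} (N? : Decidable N) (N-swap : ∀ {s} → s ∈ N → swap s ∈ N)
    (ℓ<k : suc ℓ ≤ k) {P : SepSet n} (p : P ∈ profilesAt G 𝒫 ℓ)
    where

    private
      𝒬 : Pred (SepSet n) 0ℓ
      𝒬 = extending (profilesAt G 𝒫 (suc ℓ)) P

    -- P already orients everything of order below ℓ. This is why separations of order ℓ selected
    -- above P distinguish with least order.
    undistinguished : ∀ {K L} → Consistent ⟦ K ⟧ → Consistent ⟦ L ⟧ → ⟦ P ⟧ ⊆ ⟦ K ⟧ → ⟦ P ⟧ ⊆ ⟦ L ⟧ →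
                      ¬ Distinguishes (Below ℓ) K L
    undistinguished cK cL P⊆K P⊆L (u , b , u∈K , u*∈L) =
      [ (λ u∈P → cL (P⊆L u∈P) u*∈L ≼-refl) , (λ u*∈P → cK u∈K (P⊆K u*∈P) ≼-refl) ]′
        (oriented (profilesAt⇒orientation ℓ p) b)

    levelTask : Task (systemAt G ℓ N) 𝒬
    levelTask = record
      { S? = λ s → separation? s ×-dec
               ((¬? (proj₁ s Subset.⊆? proj₂ s) ×-dec ¬? (proj₂ s Subset.⊆? proj₁ s)) ×-dec
               ((order s ≟ ℓ) ×-dec ⊆-seps? N? (nested? s)))
      ; proper = λ { (_ , (A⊈B , _) , _) (A⊆B , _) → A⊈B A⊆B }
      ; S-swap = λ { {s} (sep , pr , eq , nest) →
          separation-swap sep , swap pr , trans (order-swap s) eq , λ Nt → nested-swapˡ (nest Nt) }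
      ; profiles = filter (P ⊆ˢ?_) (levelProfiles (suc ℓ))
      ; sound = sound′
      ; complete = complete′
      ; orients = orients′
      ; feasible = feasible′
      }
      where
      sound′ : Q ∈ˡ filter (P ⊆ˢ?_) (levelProfiles (suc ℓ)) → Q ∈ 𝒬
      sound′ m with ∈-filter⁻ (P ⊆ˢ?_) {xs = levelProfiles (suc ℓ)} m
      ... | m′ , P⊆Q = levelProfiles-sound ℓ<k m′ , P⊆Q
      complete′ : Q ∈ 𝒬 → ∃[ Q′ ] Q′ ∈ˡ filter (P ⊆ˢ?_) (levelProfiles (suc ℓ)) × Q′ ≗ Q
      complete′ {Q} (q , P⊆Q) with levelProfiles-complete (suc ℓ) ℓ<k q
      ... | Q′ , m , e = Q′ , ∈-filter⁺ (P ⊆ˢ?_) m (λ x∈ → ≗⇒⊆ {P = Q} {Q′} (sym ∘ e) (P⊆Q x∈)) , e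
      orients′ : Q ∈ 𝒬 → Orientation (systemAt G ℓ N) Q
      orients′ (q , _) = record
        { oriented = λ { (sep , _ , eq , _) → oriented (profilesAt⇒orientation (suc ℓ) q) (sep , s≤s (≤-reflexive eq)) }
        ; consistent = consistent (profilesAt⇒orientation (suc ℓ) q) }
      feasible′ : ∀ {s t Q Q′} → s ∈ systemAt G ℓ N → t ∈ systemAt G ℓ N → ¬ Nested s t → Q ∈ 𝒬 → Q′ ∈ 𝒬 →
                  s ∈ ⟦ Q ⟧ → t ∈ ⟦ Q ⟧ → swap s ∈ ⟦ Q′ ⟧ → swap t ∈ ⟦ Q′ ⟧ →
                  ∃[ u ] u ∈ systemAt G ℓ N × s ≼ u × t ≼ u × u ∈ ⟦ Q ⟧ × swap u ∈ ⟦ Q′ ⟧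
      feasible′ {s} {t} {Q} {Q′} (sep , _ , eq , nest) (sep′ , _ , eq′ , nest′) s∦t
                ((q , _) , P⊆Q) ((q′ , _) , P⊆Q′) s∈Q t∈Q s*∈Q′ t*∈Q′ =
        join s t ,
        (sepᵤ , distinguished⇒proper {P = Q} {Q′} (consistent o) (consistent o′) u∈Q u*∈Q′ , ordᵤ ,
          λ Nr → nested-sym (join-nested (nested-sym (nest Nr)) (nested-sym (nest′ Nr)) s∦t)) ,
        ≼-joinˡ {s = s} {t} , ≼-joinʳ {t = t} {s} , u∈Q , u*∈Q′
        where
        o = profile⇒orientation q
        o′ = profile⇒orientation q′
        ¬d : ¬ Distinguishes (Below ℓ) Q Q′
        ¬d = undistinguished {Q} {Q′} (consistent o) (consistent o′) P⊆Q P⊆Q′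
        w : Sep n
        w = join (swap s) (swap t)
        -- If the opposite corner had order below ℓ, it would distinguish Q from Q′. So it has order
        -- at least ℓ, which leaves at most ℓ for the join.
        ℓ≤w : ℓ ≤ order w
        ℓ≤w = ≮⇒≥ λ w<ℓ → ¬d (swap w , below-swap (sepw , w<ℓ) ,
          downClosed o (below-swap (sepw , <-trans w<ℓ (n<1+n ℓ))) (≼-swap (≼-joinˡ {s = swap s} {swap t})) s∈Q ,
          profile-join q′ s*∈Q′ t*∈Q′ (<-trans w<ℓ (n<1+n ℓ)))
          where
          sepw : IsSeparation G w
          sepw = separation-join (separation-swap sep) (separation-swap sep′)
        u≤ℓ : order (join s t) ≤ ℓ
        u≤ℓ = +-cancelʳ-≤ ℓ _ _ (begin
          order (join s t) + ℓ        ≤⟨ +-monoʳ-≤ (order (join s t)) ℓ≤w ⟩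
          order (join s t) + order w  ≡⟨ order-join sep sep′ ⟩
          order s + order t           ≡⟨ cong₂ _+_ eq eq′ ⟩
          ℓ + ℓ                       ∎)
          where open ≤-Reasoning
        separator : join s t ∈ Separator ℓ Q Q′
        separator = join-separator q q′ ¬d (sep , eq , s∈Q , s*∈Q′) sep′ t∈Q u≤ℓ
        sepᵤ = proj₁ separator
        ordᵤ = proj₁ (proj₂ separator)
        u∈Q = proj₁ (proj₂ (proj₂ separator))
        u*∈Q′ = proj₂ (proj₂ (proj₂ separator))

    -- The enumeration bound applies only to tasks with a profile; a k-profile extending P provides
    -- one.
    levelTask-inhabited : ∃[ Q ] Q ∈ˡ Task.profiles levelTask
    levelTask-inhabited with extends ℓ p
    ... | K , K∈ , P⊆K with levelProfiles-complete (suc ℓ) ℓ<k (atLevel-profile ℓ<k K∈)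
    ... | Q , mQ , e = Q , ∈-filter⁺ (P ⊆ˢ?_) mQ
      λ {s} s∈P → subst T (sym (e s)) (restrict⁺ (below? (suc ℓ)) {P = K}
        (below-mono (n≤1+n ℓ) (proj₁ (proj₁ (profilesAt⇒consistentOrientation ℓ p)) s∈P)) (P⊆K s∈P))

  module _ {σ : Selector n} (sel : Selects σ) where
    open Strategy sel

    -- `efficient` is what uncrossing needs at later levels. `list` serves the count and also makes
    -- N decidable, without which the next tasks could not be set up.
    record Invariant (ℓ : ℕ) : Set where
      N : Pred (Sep n) 0ℓ
      N = iterated G σ 𝒫 ℓ
      field
        efficient     : t ∈ N → t ∈ Efficient 𝒫 × order t < ℓ
        nested        : s ∈ N → t ∈ N → Nested s t
        distinguishes : P ∈ profilesAt G 𝒫 ℓ → Q ∈ profilesAt G 𝒫 ℓ →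
                        Distinguishes (Below ℓ) P Q → Distinguishes N P Q
        list          : List (Sep n)
        list-≐        : (_∈ˡ list) ≐ N
        length-list   : length list + 4 ≤ 4 * length (levelProfiles ℓ)

    iterated-swap : ∀ ℓ → s ∈ iterated G σ 𝒫 ℓ → swap s ∈ iterated G σ 𝒫 ℓ
    iterated-swap (suc ℓ) (inj₁ m) = inj₁ (iterated-swap ℓ m)
    iterated-swap (suc ℓ) (inj₂ (P , p , d)) = inj₂ (P , p , strategySet-swap d)

    invariant-zero : Invariant 0
    invariant-zero = record
      { efficient = λ () ; nested = λ ()
      ; distinguishes = λ p _ → λ { (_ , _ , s∈P , _) → ⊥-elim (p s∈P) }
      ; list = [] ; list-≐ = (λ ()) , (λ ())
      ; length-list = 4≤ (levelProfiles-complete 0 z≤n (atLevel-profile z≤n (Ps-sound P₀∈))) }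
      where
      4≤ : ∀ {xs} → ∃[ P ] P ∈ˡ xs × P ≗ atLevel 0 P₀ → 4 ≤ 4 * length xs
      4≤ {_ ∷ xs} _ = *-monoʳ-≤ 4 (s≤s (z≤n {length xs}))

    module Step (ℓ<k : suc ℓ ≤ k) (inv : Invariant ℓ) where
      open Invariant inv

      N? : Decidable N
      N? s = map′ (proj₁ list-≐) (proj₂ list-≐) (Any.any? (s ≟ˢ_) list)

      System : Pred (Sep n) 0ℓ
      System = systemAt G ℓ N

      Above : SepSet n → Pred (SepSet n) 0ℓ
      Above P = extending (profilesAt G 𝒫 (suc ℓ)) P

      New : SepSet n → Pred (Sep n) 0ℓ
      New P = StrategySet σ System (Above P)

      N⁺ : Pred (Sep n) 0ℓ
      N⁺ = iterated G σ 𝒫 (suc ℓ)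

      task : P ∈ profilesAt G 𝒫 ℓ → Task System (Above P)
      task = levelTask N? (iterated-swap ℓ) ℓ<k

      New-resp : ⟦ P ⟧ ≐ ⟦ Q ⟧ → New P ⊆ New Q
      New-resp {P} {Q} (f , g) = strategySet-resp (id , id)
        (extending-⊆ {𝒫 = profilesAt G 𝒫 (suc ℓ)} {profilesAt G 𝒫 (suc ℓ)} {P} {Q} id g ,
         extending-⊆ {𝒫 = profilesAt G 𝒫 (suc ℓ)} {profilesAt G 𝒫 (suc ℓ)} {Q} {P} id f)

      new-relevant : P ∈ profilesAt G 𝒫 ℓ → s ∈ New P → s ∈ Relevant System (Above P)
      new-relevant p = strategySet⊆relevant (task p)

      new-nested-old : P ∈ profilesAt G 𝒫 ℓ → s ∈ New P → t ∈ N → Nested s t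
      new-nested-old p d Nt with new-relevant p d
      ... | (_ , _ , _ , nest) , _ = nest Nt

      efficient⁺ : t ∈ N⁺ → t ∈ Efficient 𝒫 × order t < suc ℓ
      efficient⁺ (inj₁ m) = proj₁ (efficient m) , <-trans (proj₂ (efficient m)) (n<1+n ℓ)
      efficient⁺ (inj₂ (P , p , d)) with new-relevant p d
      ... | (sep , _ , refl , _) , (Q , ((_ , K , K∈ , Q⊆K) , P⊆Q) , t∈Q) , (Q′ , ((_ , L , L∈ , Q′⊆L) , P⊆Q′) , t*∈Q′) =
        (sep , K , L , K∈ , L∈ , Q⊆K t∈Q , Q′⊆L t*∈Q′ ,
          undistinguished N? (iterated-swap ℓ) ℓ<k p {K} {L} (IsProfileOf.consistent (𝒫⊆ K∈)) (IsProfileOf.consistent (𝒫⊆ L∈))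
            (λ m → Q⊆K (P⊆Q m)) (λ m → Q′⊆L (P⊆Q′ m))) , n<1+n ℓ

      nested⁺ : s ∈ N⁺ → t ∈ N⁺ → Nested s t
      nested⁺ (inj₁ m) (inj₁ m′) = nested m m′
      nested⁺ (inj₁ m) (inj₂ (P , p , d)) = nested-sym (new-nested-old p d m)
      nested⁺ (inj₂ (P , p , d)) (inj₁ m) = new-nested-old p d m
      nested⁺ (inj₂ (P , p , d)) (inj₂ (P′ , p′ , d′)) with ≐-or-distinguished ℓ p p′
      ... | inj₁ P≐P′ = strategySet-nested (task p) d (New-resp (swap P≐P′) d′)
      -- Here r ∈ N, which distinguishes P from P′, plays the part that a selected separation plays
      -- between branches.
      ... | inj₂ dist with distinguishes p p′ dist | new-relevant p d | new-relevant p′ d′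
      ...   | r , Nr , r∈P , r*∈P′
            | _ , (Q , (q , P⊆Q) , s∈Q) , (R , (r′ , P⊆R) , s*∈R)
            | _ , (Q′ , (q′ , P′⊆Q′) , t∈Q′) , (R′ , (r″ , P′⊆R′) , t*∈R′) =
        nested-across
          (free-below {P = Q} {R} (con q) (con r′) s∈Q (P⊆Q r∈P) s*∈R (P⊆R r∈P) (new-nested-old p d Nr))
          (free-below {P = Q′} {R′} (con q′) (con r″) t∈Q′ (P′⊆Q′ r*∈P′) t*∈R′ (P′⊆R′ r*∈P′)
            (new-nested-old p′ d′ (iterated-swap ℓ Nr)))
        where
        con : ∀ {Q} → Q ∈ profilesAt G 𝒫 (suc ℓ) → Consistent ⟦ Q ⟧
        con q = consistent (profilesAt⇒orientation (suc ℓ) q)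

      -- Either the restrictions to level ℓ differ and N distinguishes them already, or they agree.
      -- Then s has order exactly ℓ, and once uncrossed from N it belongs to the system of a single
      -- task containing P and Q.
      distinguishes⁺ : P ∈ profilesAt G 𝒫 (suc ℓ) → Q ∈ profilesAt G 𝒫 (suc ℓ) →
                       Distinguishes (Below (suc ℓ)) P Q → Distinguishes N⁺ P Q
      distinguishes⁺ {P} {Q} pe@(p , K , K∈ , P⊆K) qe@(q , L , L∈ , Q⊆L) (s , (sep , s<) , s∈P , s*∈Q) =
        split (≐-or-distinguished ℓ p′ q′)
        where
        P′ Q′ : SepSet n
        P′ = atLevel ℓ P
        Q′ = atLevel ℓ Q
        lower : ∀ {P} → P ∈ IsProfile G (suc ℓ) → ∃[ K ] K ∈ 𝒫 × ⟦ P ⟧ ⊆ ⟦ K ⟧ → atLevel ℓ P ∈ profilesAt G 𝒫 ℓ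
        lower = lower′ ℓ
          where
          lower′ : ∀ ℓ {P} → P ∈ IsProfile G (suc ℓ) → ∃[ K ] K ∈ 𝒫 × ⟦ P ⟧ ⊆ ⟦ K ⟧ → atLevel ℓ P ∈ profilesAt G 𝒫 ℓ
          lower′ zero {P} p _ m = case proj₂ (proj₁ (atLevel⁻ {P = P} m)) of λ ()
          lower′ (suc ℓ) {P} p (K , K∈ , P⊆K) = restrict-profile (n≤1+n _) p , K , K∈ , λ m → P⊆K (proj₂ (atLevel⁻ {P = P} m))
        p′ : P′ ∈ profilesAt G 𝒫 ℓ
        p′ = lower p (K , K∈ , P⊆K)
        q′ : Q′ ∈ profilesAt G 𝒫 ℓ
        q′ = lower q (L , L∈ , Q⊆L)
        P′⊆P : ⟦ P′ ⟧ ⊆ ⟦ P ⟧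
        P′⊆P m = proj₂ (atLevel⁻ {P = P} m)
        Q′⊆Q : ⟦ Q′ ⟧ ⊆ ⟦ Q ⟧
        Q′⊆Q m = proj₂ (atLevel⁻ {P = Q} m)
        split : ⟦ P′ ⟧ ≐ ⟦ Q′ ⟧ ⊎ Distinguishes (Below ℓ) P′ Q′ → Distinguishes N⁺ P Q
        split (inj₂ dist) with distinguishes p′ q′ dist
        ... | r , Nr , r∈P′ , r*∈Q′ = r , inj₁ Nr , P′⊆P r∈P′ , Q′⊆Q r*∈Q′
        split (inj₁ P′≐Q′) = finish
          (uncross 𝒫⊆ ℓ<k p q ¬d N nested efficient list (proj₁ list-≐) (sep , ≤-antisym (s≤s⁻¹ s<) ℓ≤s , s∈P , s*∈Q))
          where
          P′⊆Q : ⟦ P′ ⟧ ⊆ ⟦ Q ⟧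
          P′⊆Q m = Q′⊆Q (proj₁ P′≐Q′ m)
          ¬d : ¬ Distinguishes (Below ℓ) P Q
          ¬d = undistinguished N? (iterated-swap ℓ) ℓ<k p′ {P} {Q} (IsProfileOf.consistent p) (IsProfileOf.consistent q) P′⊆P P′⊆Q
          ℓ≤s : ℓ ≤ order s
          ℓ≤s = undistinguished⇒≤order {P = P} {Q} ¬d sep s∈P s*∈Q
          finish : ∃[ u ] u ∈ Separator ℓ P Q × (∀ {t} → t ∈ˡ list → Nested u t) ×
                          (∀ {r} → r ∈ N → Nested r s → Nested r u) →
                   Distinguishes N⁺ P Q
          finish (u , (sepᵤ , eq , u∈P , u*∈Q) , nests , _) with
            strategySet-distinguishes {P = P} {Q} (task p′) (pe , P′⊆P) (qe , P′⊆Q)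
              (u , (sepᵤ , distinguished⇒proper {P = P} {Q} (IsProfileOf.consistent p) (IsProfileOf.consistent q) u∈P u*∈Q , eq ,
                    λ Nt → nests (proj₂ list-≐ Nt)) , u∈P , u*∈Q)
          ... | r , d , r∈P , r*∈Q = r , inj₂ (P′ , p′ , d) , r∈P , r*∈Q

      lower-profile : P ∈ˡ levelProfiles ℓ → P ∈ profilesAt G 𝒫 ℓ
      lower-profile = levelProfiles-sound (≤-trans (n≤1+n ℓ) ℓ<k)

      disjoint : ∀ {qs} → (∀ {P} → P ∈ˡ qs → P ∈ profilesAt G 𝒫 ℓ) → AllPairs (λ P Q → ¬ P ≗ Q) qs →
                 AllPairs (DisjointOn (λ P Q → ⟦ P ⟧ ⊆ ⟦ Q ⟧) (levelProfiles (suc ℓ))) qs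
      disjoint h [] = []
      disjoint {P ∷ qs} h (ne ∷ ap) =
        All.tabulate (λ {P′} m′ {Q} mQ P⊆Q P′⊆Q →
          [ (λ P≐P′ → All.lookup ne m′ (≐⇒≗ {P = P} {P′} P≐P′))
          , (λ { (r , _ , r∈P , r*∈P′) →
              antisymmetric (profilesAt⇒orientation (suc ℓ) (levelProfiles-sound ℓ<k mQ)) (P⊆Q r∈P) (P′⊆Q r*∈P′) }) ]′
          (≐-or-distinguished ℓ (h (here refl)) (h (there m′))))
        ∷ disjoint (h ∘ there) ap

      sum-lengths≤ : sum (map (λ P → length (filter (P ⊆ˢ?_) (levelProfiles (suc ℓ)))) (levelProfiles ℓ)) ≤
                     length (levelProfiles (suc ℓ))
      sum-lengths≤ = sum-length-filter≤ _⊆ˢ?_ (levelProfiles ℓ) (levelProfiles (suc ℓ))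
        (disjoint lower-profile (deduplicate-distinct _≗?_ (map (atLevel ℓ) Ps)))

      new≐ : (λ s → ∃[ P ] P ∈ˡ levelProfiles ℓ × s ∈ New P) ≐ (λ s → ∃[ P ] P ∈ profilesAt G 𝒫 ℓ × s ∈ New P)
      new≐ = (λ { (P , m , d) → P , lower-profile m , d }) , from
        where
        from : ∀ {s} → ∃[ P ] P ∈ profilesAt G 𝒫 ℓ × s ∈ New P → ∃[ P ] P ∈ˡ levelProfiles ℓ × s ∈ New P
        from (P , p , d) with levelProfiles-complete ℓ (≤-trans (n≤1+n ℓ) ℓ<k) p
        ... | Q , m , e = Q , m , New-resp {P} {Q} (≗⇒⊆ {P = P} {Q} (sym ∘ e) , ≗⇒⊆ {P = Q} {P} e) d

      NewList : Set
      NewList = ∃[ zs ] (_∈ˡ zs) ≐ (λ s → ∃[ P ] P ∈ˡ levelProfiles ℓ × s ∈ New P) ×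
        length zs + 4 * length (levelProfiles ℓ) ≤
        4 * sum (map (λ P → length (filter (P ⊆ˢ?_) (levelProfiles (suc ℓ)))) (levelProfiles ℓ))

      newList : NewList
      newList = collect _ 4 4 (levelProfiles ℓ) λ {P} m →
        strategySet-enumeration (task (lower-profile m))
          (proj₂ (levelTask-inhabited N? (iterated-swap ℓ) ℓ<k (lower-profile m)))

      invariant⁺ : NewList → Invariant (suc ℓ)
      invariant⁺ (zs , zs≐ , zs≤) = record
        { efficient = efficient⁺
        ; nested = nested⁺
        ; distinguishes = distinguishes⁺
        ; list = list ++ zs
        ; list-≐ = (λ m → Sum.map (proj₁ list-≐) (λ m′ → proj₁ new≐ (proj₁ zs≐ m′)) (∈-++⁻ list m)) ,
                   [ (λ m → ∈-++⁺ˡ (proj₂ list-≐ m)) , (λ m → ∈-++⁺ʳ list (proj₂ zs≐ (proj₂ new≐ m))) ]′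
        ; length-list = ≤-trans (length-++-bound list zs length-list zs≤) (*-monoʳ-≤ 4 sum-lengths≤)
        }

    invariant : ∀ ℓ → ℓ ≤ k → Invariant ℓ
    invariant zero _ = invariant-zero
    invariant (suc ℓ) ℓ<k = Step.invariant⁺ ℓ<k inv (Step.newList ℓ<k inv)
      where inv = invariant ℓ (≤-trans (n≤1+n ℓ) ℓ<k)

-- Cardinalities and the final bounds

module _ {A : Set} where

  lookup-injective : {xs : List A} → AllPairs _≢_ xs → Injective _≡_ _≡_ (lookup xs)
  lookup-injective (ne ∷ u) {zero} {zero} eq = refl
  lookup-injective (ne ∷ u) {zero} {suc j} eq = ⊥-elim (All.lookup ne (∈-lookup j) eq)
  lookup-injective (ne ∷ u) {suc i} {zero} eq = ⊥-elim (All.lookup ne (∈-lookup i) (sym eq))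
  lookup-injective (ne ∷ u) {suc i} {suc j} eq = cong suc (lookup-injective u eq)

  list⇒hasCardinality : {X : Pred A 0ℓ} {xs : List A} → AllPairs _≢_ xs → (_∈ˡ xs) ≐ X →
                        HasCardinality _≡_ X (length xs)
  list⇒hasCardinality {xs = xs} u (snd , cmp) = record
    { enum = lookup xs
    ; sound = λ i → snd (∈-lookup i)
    ; injective = lookup-injective u
    ; complete = λ Xx → Any.index (cmp Xx) , sym (lookup-index (cmp Xx)) }

module _ {n : ℕ} (G : Graph n) where

  -- Level 0 still has the profile ∅, but relevance at any later level would need a member of 𝒫.
  iterated-∅ : ∀ {σ 𝒫} → 𝒫 ⊆ ∅ → ∀ ℓ → iterated G σ 𝒫 ℓ ⊆ ∅
  iterated-∅ none (suc ℓ) (inj₁ m) = iterated-∅ none ℓ m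
  iterated-∅ none (suc ℓ) (inj₂ (_ , _ , select (_ , _ , (_ , ((_ , _ , K∈ , _) , _) , _) , _) _)) = none K∈
  iterated-∅ none (suc ℓ) (inj₂ (_ , _ , recurse (_ , _ , (_ , ((_ , _ , K∈ , _) , _) , _) , _) _ _ _)) = none K∈

  ∅⇒hasCardinality : {X : Pred (Sep n) 0ℓ} → X ⊆ ∅ → HasCardinality _≡_ X 0
  ∅⇒hasCardinality none = record
    { enum = λ () ; sound = λ () ; injective = λ { {()} } ; complete = λ Xx → ⊥-elim (none Xx) }

  module Nonempty {k : ℕ} {𝒫 : Pred (SepSet n) 0ℓ} (𝒫⊆ : 𝒫 ⊆ IsProfile G (suc k))
    {p : ℕ} (card : HasCardinality _≗_ 𝒫 (suc p))
    where
    open HasCardinality card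
    open GraphSeparations G

    Ps : List (SepSet n)
    Ps = tabulate enum

    Ps-sound : ∀ {P} → P ∈ˡ Ps → P ∈ 𝒫
    Ps-sound m with ∈-tabulate⁻ {f = enum} m
    ... | i , refl = sound i

    Ps-complete : ∀ {P} → P ∈ 𝒫 → ∃[ Q ] Q ∈ˡ Ps × Q ≗ P
    Ps-complete P∈ with complete P∈
    ... | i , e = enum i , ∈-tabulate⁺ {f = enum} i , e

    open Iterated G 𝒫⊆ Ps Ps-sound Ps-complete (here refl)
    open Corners G

    top : ∀ {P} → P ∈ 𝒫 → P ∈ profilesAt G 𝒫 (suc k)
    top P∈ = 𝒫⊆ P∈ , _ , P∈ , id

    module _ {σ : Selector n} (sel : Selects σ) where
      open Invariant (invariant sel (suc k) ≤-refl)

      elements : List (Sep n)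
      elements = deduplicate _≟ˢ_ list

      elements-≐ : (_∈ˡ elements) ≐ N
      elements-≐ = (λ m → proj₁ list-≐ (∈-deduplicate⁻ _≟ˢ_ list m)) ,
                   (λ Ns → ∈-deduplicate⁺ _≟ˢ_ (proj₂ list-≐ Ns))

      size : ℕ
      size = length elements

      hasSize : HasCardinality _≡_ N size
      hasSize = list⇒hasCardinality (deduplicate-distinct _≟ˢ_ list) elements-≐

      size-least : ∀ {xs} → N ⊆ (_∈ˡ xs) → size ≤ length xs
      size-least N⊆ = unique-⊆⇒length≤ (deduplicate-distinct _≟ˢ_ list) (λ m → N⊆ (proj₁ elements-≐ m))

      size≤ : size ≤ 4 * p
      size≤ = +-cancelʳ-≤ 4 _ _ (begin
        size + 4                              ≤⟨ +-monoˡ-≤ 4 (length-deduplicate≤ _≟ˢ_ list) ⟩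
        length list + 4                       ≤⟨ length-list ⟩
        4 * length (levelProfiles (suc k))    ≤⟨ *-monoʳ-≤ 4 (length-levelProfiles≤ (suc k)) ⟩
        4 * length Ps                         ≡⟨ cong (4 *_) (length-tabulate enum) ⟩
        4 * suc p                             ≡⟨ *-suc 4 p ⟩
        4 + 4 * p                             ≡⟨ +-comm 4 _ ⟩
        4 * p + 4                             ∎)
        where open ≤-Reasoning

      ≤size : 2 * p ≤ size
      -- The profile `enum zero` is the root, and each of the other p profiles contributes two
      -- separations.
      ≤size = ≤-trans (*-monoʳ-≤ 2 (≤-reflexive (sym (length-tabulate (enum ∘ suc)))))
        (NestedSystem.2*length≤ N? nested (iterated-swap sel (suc k))
          (orients (sound zero)) (tabulate (enum ∘ suc)) (λ m → orients (Ps-sound (there m)))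
          (AllPairs.tabulate⁺ distinguished) (proj₂ elements-≐))
        where
        N? : Decidable N
        N? s = map′ (proj₁ list-≐) (proj₂ list-≐) (Any.any? (s ≟ˢ_) list)
        orients : ∀ {P} → P ∈ 𝒫 → Orientation N P
        orients P∈ = record
          { oriented = λ Ns → oriented (profile⇒orientation (𝒫⊆ P∈)) (proj₁ (proj₁ (efficient Ns)) , proj₂ (efficient Ns))
          ; consistent = consistent (profile⇒orientation (𝒫⊆ P∈)) }
        distinguished : ∀ {i j} → i ≢ j → Distinguishes N (enum i) (enum j)
        distinguished {i} {j} i≢j with ≐-or-distinguished (suc k) (top (sound i)) (top (sound j))
        ... | inj₁ e = ⊥-elim (i≢j (injective (≐⇒≗ {P = enum i} {enum j} e)))
        ... | inj₂ d = distinguishes (top (sound i)) (top (sound j)) d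

    module _ (connected : Connected G k) where
      private
        inv = invariant extᵣ-selects k (n≤1+n k)
        open Step extᵣ-selects ≤-refl inv

      -- A separation selected before the last level is proper, so its fewer than k common vertices
      -- would separate G.
      lower-∅ : iterated G extᵣ 𝒫 k ⊆ ∅
      lower-∅ {t} m with Invariant.efficient inv m
      ... | (sep , K , L , K∈ , L∈ , t∈K , t*∈L , _) , t<k =
        proj₂ connected _ t<k (proper⇒separates sep
          (distinguished⇒proper {P = K} {L} (IsProfileOf.consistent (𝒫⊆ K∈)) (IsProfileOf.consistent (𝒫⊆ L∈)) t∈K t*∈L))

      extSize≤ : size extᵣ-selects ≤ 2 * suc p
      -- Only a cover is wanted, so soundness is trivial (`U`), and with no lower levels to pay for
      -- no surplus is kept.
      extSize≤ = bound (collect {F = λ _ → U} {New} (λ P → length (filter (P ⊆ˢ?_) (levelProfiles (suc k))))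
        2 0 (levelProfiles k) λ m → cover (task (lower-profile m)))
        where
        cover : ∀ {S 𝒬} (τ : Task S 𝒬) →
                ∃[ xs ] ((_∈ˡ xs) ⊆ U × StrategySet extᵣ S 𝒬 ⊆ (_∈ˡ xs)) × length xs + 0 ≤ 2 * length (Task.profiles τ)
        cover τ with extStrategySet-cover τ
        ... | xs , inc , le = xs , ((λ _ → _) , inc) , subst (_≤ _) (sym (+-identityʳ _)) le
        open ≤-Reasoning
        bound : ∃[ zs ] ((_∈ˡ zs) ⊆ (λ s → ∃[ P ] P ∈ˡ levelProfiles k × s ∈ U) ×
                         (λ s → ∃[ P ] P ∈ˡ levelProfiles k × s ∈ New P) ⊆ (_∈ˡ zs)) ×
                  length zs + 0 ≤ 2 * sum (map (λ P → length (filter (P ⊆ˢ?_) (levelProfiles (suc k)))) (levelProfiles k)) →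
                size extᵣ-selects ≤ 2 * suc p
        bound (zs , (_ , inc) , le) = begin
          size extᵣ-selects                   ≤⟨ size-least extᵣ-selects N⊆zs ⟩
          length zs                           ≡⟨ +-identityʳ _ ⟨
          length zs + 0                       ≤⟨ ≤-trans le (*-monoʳ-≤ 2 sum-lengths≤) ⟩
          2 * length (levelProfiles (suc k))  ≤⟨ *-monoʳ-≤ 2 (length-levelProfiles≤ (suc k)) ⟩
          2 * length Ps                       ≡⟨ cong (2 *_) (length-tabulate enum) ⟩
          2 * suc p                           ∎
          where
          N⊆zs : iterated G extᵣ 𝒫 (suc k) ⊆ (_∈ˡ zs)
          N⊆zs (inj₁ m) = ⊥-elim (lower-∅ m)
          N⊆zs (inj₂ m) = inc (proj₂ new≐ m)

theorem2p2 : ∀ {n} (G : Graph n) (k : ℕ) → 1 ≤ k →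
    (𝒫 : Pred (SepSet n) 0ℓ) → 𝒫 ⊆ IsProfile G k →
    (p : ℕ) → HasCardinality _≗_ 𝒫 p →
    ∃[ e ] ∃[ l ]
    HasCardinality _≡_ (N-Ext G k 𝒫) e ×
    HasCardinality _≡_ (N-Loc G k 𝒫) l ×
    (2 * (p ∸ 1) ≤ e × e ≤ 4 * (p ∸ 1)) ×
    (2 * (p ∸ 1) ≤ l × l ≤ 4 * (p ∸ 1)) ×
    (Connected G (k ∸ 1) → e ≤ 2 * p)
-- Without profiles there is no root for the tree; both sets are empty and `p ∸ 1` is 0.
theorem2p2 G (suc k) _ 𝒫 𝒫⊆ zero card =
  0 , 0 , ∅⇒hasCardinality G (iterated-∅ G none (suc k)) , ∅⇒hasCardinality G (iterated-∅ G none (suc k)) ,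
  (z≤n , z≤n) , (z≤n , z≤n) , λ _ → z≤n
  where
  none : 𝒫 ⊆ ∅
  none P∈ = case proj₁ (HasCardinality.complete card P∈) of λ ()
theorem2p2 G (suc k) _ 𝒫 𝒫⊆ (suc p) card =
  size extᵣ-selects , size locᵣ-selects , hasSize extᵣ-selects , hasSize locᵣ-selects ,
  (≤size extᵣ-selects , size≤ extᵣ-selects) , (≤size locᵣ-selects , size≤ locᵣ-selects) , extSize≤
  where open Nonempty G 𝒫⊆ card
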